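{- Let $n\ge 2$, $t\ge 2$, let $V$ be a $2n$-dimensional $\mathbb{F}_{q^t}$-vector space with $V=U_1\oplus U_2$, $\dim U_1=\dim U_2=n$, and put $T_1=PG(U_1,\mathbb{F}_{q^t})$, $T_2=PG(U_2,\mathbb{F}_{q^t})$ (two disjoint $(n-1)$-dimensional subspaces of $\Lambda=PG(V,\mathbb{F}_{q^t})=PG(2n-1,q^t)$). Let $f:U_1\to U_2$ be an invertible semilinear map with companion automorphism $\sigma\in\mathrm{Aut}(\mathbb{F}_{q^t})$ such that $\mathrm{Fix}(\sigma)=\mathbb{F}_q$, and let $\Phi_f:T_1\to T_2$ be the induced collineation, $\langle\mathbf u\rangle_{q^t}\mapsto\langle f(\mathbf u)\rangle_{q^t}$. Then for every $\rho\in\mathbb{F}_{q^t}^*$ the set $$L_{\rho,f}=\{\langle \mathbf u+\rho f(\mathbf u)\rangle_{q^t}:\mathbf u\in U_1\setminus\{\mathbf 0\}\},$$ which is the $\mathbb{F}_q$-linear set defined by the $\mathbb{F}_q$-subspace $W_{\rho,f}=\{\mathbf u+\rho f(\mathbf u):\mathbf u\in U_1\}$ (of $\mathbb{F}_q$-dimension $tn$), is an $\mathbb{F}_q$-linear set of $\Lambda$ of pseudoregulus type, whose associated pseudoregulus is $\{\langle P,P^{\Phi_f}\rangle_{q^t}:P\in T_1\}$ and whose transversal spaces are $T_1$ and $T_2$.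
   Context: A map $f:U_1\to U_2$ between $\mathbb{F}_{q^t}$-spaces is semilinear with companion automorphism $\sigma$ if it is additive and $f(\lambda\mathbf u)=\lambda^\sigma f(\mathbf u)$ for all $\lambda\in\mathbb{F}_{q^t}$. For an $\mathbb{F}_q$-subspace $U$ of $V$, $L_U=\{\langle \mathbf u\rangle_{q^t}:\mathbf u\in U\setminus\{\mathbf 0\}\}$ is the $\mathbb{F}_q$-linear set defined by $U$, of rank $\dim_{\mathbb{F}_q}U$; the weight of a subspace $PG(W,\mathbb{F}_{q^t})$ in $L_U$ is $\dim_{\mathbb{F}_q}(W\cap U)$; $L_U$ is scattered if every point has weight 1. Definition (pseudoregulus type): for integers $t,n\ge 2$, a scattered $\mathbb{F}_q$-linear set $L=L_U$ of $\Lambda=PG(2n-1,q^t)$ of rank $tn$ is of pseudoregulus type if (i) there exist $m=(q^{nt}-1)/(q^t-1)$ pairwise disjoint lines $s_1,\dots,s_m$ of $\Lambda$ each having weight $t$ in $L$, and (ii) there exist exactly two $(n-1)$-dimensional subspaces $T_1,T_2$ of $\Lambda$ disjoint from $L$ such that $T_j\cap s_i\neq\emptyset$ for all $i,j$. The set $\{s_1,\dots,s_m\}$ is called the pseudoregulus associated with $L$, and $T_1,T_2$ its transversal spaces. -}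

module Defs where

open import Level using (Level; suc)
open import Algebra.Bundles using (Ring; CommutativeRing; CommutativeMonoid)
open import Algebra.Module.Bundles using (LeftModule)
open import Algebra.Morphism.Bundles using (RingHomomorphism)
import Algebra.Properties.CommutativeSemigroup as CommutativeSemigroupProperties
import Algebra.Properties.Group as GroupProperties
import Algebra.Properties.Monoid.Sum as Sum
open import Data.Fin using (Fin)
open import Data.Nat as ℕ using (ℕ; _∸_; _^_)
open import Data.Product using (∃; Σ; _×_; _,_; proj₁; proj₂)
open import Data.Sum using (_⊎_)
open import Data.Unit.Polymorphic using (⊤)
open import Function.Bundles using (Inverse; _⇔_; Equivalence)
open import Function.Definitions using (Bijective)
open import Relation.Binary.Definitions using (_Respects_)
open import Relation.Binary.PropositionalEquality using (_≡_; _≢_; setoid)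
import Relation.Binary.Reasoning.Setoid as SetoidReasoning
open import Relation.Nullary using (¬_)
open import Relation.Unary using (Pred; _∈_; _≐_)

private
  variable
    ℓ : Level

record IsField (F : CommutativeRing ℓ ℓ) : Set ℓ where
  open CommutativeRing F
  field
    1≉0     : ¬ 1# ≈ 0#
    inverse : ∀ x → ¬ x ≈ 0# → ∃ λ y → x * y ≈ 1#

-- The enumeration also makes equality in the field decidable.
record IsFiniteField (F : CommutativeRing ℓ ℓ) (order : ℕ) : Set ℓ where
  field
    isField     : IsField F
    enumeration : Inverse (setoid (Fin order)) (CommutativeRing.setoid F)

module _ {R : Ring ℓ ℓ} where

  record Submodule (M : LeftModule R ℓ ℓ) : Set (suc ℓ) where
    open LeftModule M
    field
      Mem      : Pred Carrierᴹ ℓ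
      resp     : Mem Respects _≈ᴹ_
      0∈       : 0ᴹ ∈ Mem
      +-closed : ∀ {u v} → u ∈ Mem → v ∈ Mem → (u +ᴹ v) ∈ Mem
      *-closed : ∀ a {v} → v ∈ Mem → (a *ₗ v) ∈ Mem

  module _ {M : LeftModule R ℓ ℓ} where
    private
      module R = Ring R
      module M = LeftModule M
    open M using (Carrierᴹ; _≈ᴹ_; _+ᴹ_; _*ₗ_; 0ᴹ; -ᴹ_)
    open Submodule

    infix 4 _∈ₛ_ _≐ₛ_
    infixr 7 _∩ₛ_
    infixr 6 _∨_

    _∈ₛ_ : Carrierᴹ → Submodule M → Set ℓ
    v ∈ₛ U = v ∈ Mem U

    _≐ₛ_ : Submodule M → Submodule M → Set ℓ
    U ≐ₛ W = Mem U ≐ Mem W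

    full : Submodule M
    full = record
      { Mem = λ _ → ⊤ ; resp = λ _ _ → _ ; 0∈ = _
      ; +-closed = λ _ _ → _ ; *-closed = λ _ _ → _ }

    _∩ₛ_ : Submodule M → Submodule M → Submodule M
    U ∩ₛ W = record
      { Mem      = λ v → v ∈ₛ U × v ∈ₛ W
      ; resp     = λ { e (p , p′) → resp U e p , resp W e p′ }
      ; 0∈       = 0∈ U , 0∈ W
      ; +-closed = λ { (p , p′) (r , r′) → +-closed U p r , +-closed W p′ r′ }
      ; *-closed = λ { a (p , p′) → *-closed U a p , *-closed W a p′ }
      }

    open CommutativeSemigroupProperties
      (CommutativeMonoid.commutativeSemigroup M.+ᴹ-commutativeMonoid)
      using (interchange)

    _∨_ : Submodule M → Submodule M → Submodule M
    U ∨ W = record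
      { Mem      = λ v → ∃ λ u → ∃ λ w → u ∈ₛ U × w ∈ₛ W × v ≈ᴹ u +ᴹ w
      ; resp     = λ { e (u , w , p , r , eq) →
                       u , w , p , r , M.≈ᴹ-trans (M.≈ᴹ-sym e) eq }
      ; 0∈       = 0ᴹ , 0ᴹ , 0∈ U , 0∈ W , M.≈ᴹ-sym (M.+ᴹ-identityˡ 0ᴹ)
      ; +-closed = λ { (u , w , p , r , eq) (u′ , w′ , p′ , r′ , eq′) →
                       u +ᴹ u′ , w +ᴹ w′ , +-closed U p p′ , +-closed W r r′ ,
                       M.≈ᴹ-trans (M.+ᴹ-cong eq eq′) (interchange u w u′ w′) }
      ; *-closed = λ { a (u , w , p , r , eq) →
                       a *ₗ u , a *ₗ w , *-closed U a p , *-closed W a r ,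
                       M.≈ᴹ-trans (M.*ₗ-congˡ eq) (M.*ₗ-distribˡ a u w) }
      }

    ⟨_⟩ : Carrierᴹ → Submodule M
    ⟨ u ⟩ = record
      { Mem      = λ v → ∃ λ c → v ≈ᴹ c *ₗ u
      ; resp     = λ { e (c , eq) → c , M.≈ᴹ-trans (M.≈ᴹ-sym e) eq }
      ; 0∈       = R.0# , M.≈ᴹ-sym (M.*ₗ-zeroˡ u)
      ; +-closed = λ { (c , eq) (d , eq′) → c R.+ d ,
                       M.≈ᴹ-trans (M.+ᴹ-cong eq eq′) (M.≈ᴹ-sym (M.*ₗ-distribʳ u c d)) }
      ; *-closed = λ { a (c , eq) → a R.* c ,
                       M.≈ᴹ-trans (M.*ₗ-congˡ eq) (M.≈ᴹ-sym (M.*ₗ-assoc a c u)) }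
      }

    record HasDim (U : Submodule M) (d : ℕ) : Set ℓ where
      open Sum M.+ᴹ-monoid using (sum)
      field
        basis       : Fin d → Carrierᴹ
        basis∈      : ∀ i → basis i ∈ₛ U
        independent : ∀ (c : Fin d → R.Carrier) → sum (λ i → c i *ₗ basis i) ≈ᴹ 0ᴹ →
                      ∀ i → c i R.≈ R.0#
        spanning    : ∀ {v} → v ∈ₛ U → ∃ λ (c : Fin d → R.Carrier) →
                      v ≈ᴹ sum (λ i → c i *ₗ basis i)

    record IsDirectSum (U₁ U₂ : Submodule M) : Set ℓ where
      field
        spanning    : ∀ v → v ∈ₛ U₁ ∨ U₂
        independent : ∀ {v} → v ∈ₛ U₁ → v ∈ₛ U₂ → v ≈ᴹ 0ᴹ

    private
      -‿closed : (U : Submodule M) → ∀ {v} → v ∈ₛ U → (-ᴹ v) ∈ₛ U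
      -‿closed U {v} v∈U = resp U -1v≈-v (*-closed U (R.- R.1#) v∈U)
        where
        open SetoidReasoning M.≈ᴹ-setoid
        -1v≈-v : (R.- R.1#) *ₗ v ≈ᴹ -ᴹ v
        -1v≈-v = begin
          (R.- R.1#) *ₗ v                          ≈⟨ M.+ᴹ-identityʳ _ ⟨
          (R.- R.1#) *ₗ v +ᴹ 0ᴹ                    ≈⟨ M.+ᴹ-congˡ (M.-ᴹ‿inverseʳ v) ⟨
          (R.- R.1#) *ₗ v +ᴹ (v +ᴹ -ᴹ v)           ≈⟨ M.+ᴹ-assoc _ v (-ᴹ v) ⟨
          ((R.- R.1#) *ₗ v +ᴹ v) +ᴹ -ᴹ v
            ≈⟨ M.+ᴹ-congʳ (M.+ᴹ-congˡ (M.*ₗ-identityˡ v)) ⟨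
          ((R.- R.1#) *ₗ v +ᴹ R.1# *ₗ v) +ᴹ -ᴹ v
            ≈⟨ M.+ᴹ-congʳ (M.*ₗ-distribʳ v (R.- R.1#) R.1#) ⟨
          ((R.- R.1# R.+ R.1#) *ₗ v) +ᴹ -ᴹ v
            ≈⟨ M.+ᴹ-congʳ (M.*ₗ-congʳ (R.-‿inverseˡ R.1#)) ⟩
          (R.0# *ₗ v) +ᴹ -ᴹ v                      ≈⟨ M.+ᴹ-congʳ (M.*ₗ-zeroˡ v) ⟩
          0ᴹ +ᴹ -ᴹ v                               ≈⟨ M.+ᴹ-identityˡ _ ⟩
          -ᴹ v                                     ∎

    asModule : Submodule M → LeftModule R ℓ ℓ
    asModule U = record
      { Carrierᴹ = Σ Carrierᴹ (Mem U)
      ; _≈ᴹ_     = λ u v → proj₁ u ≈ᴹ proj₁ v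
      ; _+ᴹ_     = λ { (u , p) (v , r) → u +ᴹ v , +-closed U p r }
      ; _*ₗ_     = λ { a (v , p) → a *ₗ v , *-closed U a p }
      ; 0ᴹ       = 0ᴹ , 0∈ U
      ; -ᴹ_      = λ { (v , p) → -ᴹ v , -‿closed U p }
      ; isLeftModule = record
        { isLeftSemimodule = record
          { +ᴹ-isCommutativeMonoid = record
            { isMonoid = record
              { isSemigroup = record
                { isMagma = record
                  { isEquivalence = record
                    { refl = M.≈ᴹ-refl ; sym = M.≈ᴹ-sym ; trans = M.≈ᴹ-trans }
                  ; ∙-cong = M.+ᴹ-cong
                  }
                ; assoc = λ u v w → M.+ᴹ-assoc (proj₁ u) (proj₁ v) (proj₁ w)
                }
              ; identity = (λ v → M.+ᴹ-identityˡ (proj₁ v))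
                         , (λ v → M.+ᴹ-identityʳ (proj₁ v))
              }
            ; comm = λ u v → M.+ᴹ-comm (proj₁ u) (proj₁ v)
            }
          ; isPreleftSemimodule = record
            { *ₗ-cong      = M.*ₗ-cong
            ; *ₗ-zeroˡ     = λ v → M.*ₗ-zeroˡ (proj₁ v)
            ; *ₗ-distribʳ  = λ v → M.*ₗ-distribʳ (proj₁ v)
            ; *ₗ-identityˡ = λ v → M.*ₗ-identityˡ (proj₁ v)
            ; *ₗ-assoc     = λ a b v → M.*ₗ-assoc a b (proj₁ v)
            ; *ₗ-zeroʳ     = M.*ₗ-zeroʳ
            ; *ₗ-distribˡ  = λ a u v → M.*ₗ-distribˡ a (proj₁ u) (proj₁ v)
            }
          }
        ; -ᴹ‿cong    = M.-ᴹ‿cong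
        ; -ᴹ‿inverse = (λ v → M.-ᴹ‿inverseˡ (proj₁ v))
                     , (λ v → M.-ᴹ‿inverseʳ (proj₁ v))
        }
      }

record IsSemilinear {F : Ring ℓ ℓ} (σ : Ring.Carrier F → Ring.Carrier F)
                    (M N : LeftModule F ℓ ℓ)
                    (f : LeftModule.Carrierᴹ M → LeftModule.Carrierᴹ N) : Set ℓ where
  private
    module M = LeftModule M
    module N = LeftModule N
  field
    cong          : ∀ {u v} → u M.≈ᴹ v → f u N.≈ᴹ f v
    additive      : ∀ u v → f (u M.+ᴹ v) N.≈ᴹ f u N.+ᴹ f v
    σ-homogeneous : ∀ a u → f (a M.*ₗ u) N.≈ᴹ σ a N.*ₗ f u

HasFixedField :
  {K F : CommutativeRing ℓ ℓ} →
  RingHomomorphism (CommutativeRing.rawRing K) (CommutativeRing.rawRing F) →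
  (CommutativeRing.Carrier F → CommutativeRing.Carrier F) → Set ℓ
HasFixedField {F = F} ι σ = ∀ a → σ a ≈ a ⇔ (∃ λ k → ⟦ k ⟧ ≈ a)
  where
  open CommutativeRing F using (_≈_)
  open RingHomomorphism ι using (⟦_⟧)

module _ {K F : Ring ℓ ℓ} (ι : RingHomomorphism (Ring.rawRing K) (Ring.rawRing F)) where
  private
    module ι = RingHomomorphism ι

  restrictScalars : LeftModule F ℓ ℓ → LeftModule K ℓ ℓ
  restrictScalars V = record
    { Carrierᴹ = Carrierᴹ
    ; _≈ᴹ_     = _≈ᴹ_
    ; _+ᴹ_     = _+ᴹ_
    ; _*ₗ_     = λ k v → ι.⟦ k ⟧ *ₗ v
    ; 0ᴹ       = 0ᴹ
    ; -ᴹ_      = -ᴹ_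
    ; isLeftModule = record
      { isLeftSemimodule = record
        { +ᴹ-isCommutativeMonoid = +ᴹ-isCommutativeMonoid
        ; isPreleftSemimodule = record
          { *ₗ-cong      = λ e e′ → *ₗ-cong (ι.⟦⟧-cong e) e′
          ; *ₗ-zeroˡ     = λ v → ≈ᴹ-trans (*ₗ-congʳ ι.0#-homo) (*ₗ-zeroˡ v)
          ; *ₗ-distribʳ  = λ v k l → ≈ᴹ-trans (*ₗ-congʳ (ι.+-homo k l)) (*ₗ-distribʳ v _ _)
          ; *ₗ-identityˡ = λ v → ≈ᴹ-trans (*ₗ-congʳ ι.1#-homo) (*ₗ-identityˡ v)
          ; *ₗ-assoc     = λ k l v → ≈ᴹ-trans (*ₗ-congʳ (ι.*-homo k l)) (*ₗ-assoc _ _ v)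
          ; *ₗ-zeroʳ     = λ k → *ₗ-zeroʳ _
          ; *ₗ-distribˡ  = λ k → *ₗ-distribˡ _
          }
        }
      ; -ᴹ‿cong    = -ᴹ‿cong
      ; -ᴹ‿inverse = -ᴹ‿inverse
      }
    }
    where open LeftModule V

  restrictSubmodule : {V : LeftModule F ℓ ℓ} → Submodule V → Submodule (restrictScalars V)
  restrictSubmodule U = record
    { Mem = Mem ; resp = resp ; 0∈ = 0∈
    ; +-closed = +-closed ; *-closed = λ k → *-closed ι.⟦ k ⟧ }
    where open Submodule U

-- A point of PG(U), given by homogeneous coordinates; two points P and Q
-- coincide when ⟪ P ⟫ ≐ₛ ⟪ Q ⟫.
record Point {F : Ring ℓ ℓ} {V : LeftModule F ℓ ℓ} (U : Submodule V) : Set ℓ where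
  open LeftModule V
  field
    vec   : Carrierᴹ
    vec∈  : vec ∈ₛ U
    vec≉0 : ¬ vec ≈ᴹ 0ᴹ

  ⟪_⟫ : Submodule V
  ⟪_⟫ = ⟨ vec ⟩

open Point public using (⟪_⟫)

-- Here Λ = PG(V), the scalars of the linear sets are K, embedded in F by ι,
-- and projective subspaces are given by their underlying vector subspaces, so
-- that vector dimension exceeds projective dimension by one.
module LinearSets
  {K F : CommutativeRing ℓ ℓ}
  (ι : RingHomomorphism (CommutativeRing.rawRing K) (CommutativeRing.rawRing F))
  (V : LeftModule (CommutativeRing.ring F) ℓ ℓ)
  where

  private
    module V = LeftModule V
  open V using (Carrierᴹ; _≈ᴹ_; 0ᴹ)

  Subspace : Set (suc ℓ)
  Subspace = Submodule V

  K-Subspace : Set (suc ℓ)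
  K-Subspace = Submodule (restrictScalars {K = CommutativeRing.ring K} ι V)

  Λ : Set ℓ
  Λ = Point (full {M = V})

  PointSet : Set (suc ℓ)
  PointSet = Pred Λ ℓ

  infix 4 _on_

  _on_ : Λ → Subspace → Set ℓ
  P on W = Point.vec P ∈ₛ W

  Disjoint : Subspace → Subspace → Set ℓ
  Disjoint W W′ = ¬ ∃ λ P → P on W × P on W′

  Meets : Subspace → Subspace → Set ℓ
  Meets W W′ = ∃ λ P → P on W × P on W′

  DisjointFrom : Subspace → PointSet → Set ℓ
  DisjointFrom W L = ¬ ∃ λ P → P on W × P ∈ L

  L[_] : K-Subspace → PointSet
  L[ U ] P = ∃ λ u → u ∈ₛ U × ¬ u ≈ᴹ 0ᴹ × ⟪ P ⟫ ≐ₛ ⟨ u ⟩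

  HasWeight : K-Subspace → Subspace → ℕ → Set ℓ
  HasWeight U W = HasDim (restrictSubmodule ι W ∩ₛ U)

  Scattered : K-Subspace → Set ℓ
  Scattered U = ∀ P → P ∈ L[ U ] → HasWeight U ⟪ P ⟫ 1

  -- The set L is of pseudoregulus type, with U, s, T₁, T₂ the data exhibiting it
  -- as such.  Weights depend on the choice of U, so U is a parameter.  The
  -- standing assumptions are |K| = q, |F| = qᵗ, dim V = 2n and n, t ≥ 2; since
  -- qᵗ > 1, the equation m≡ says that m is the quotient (qⁿᵗ - 1) / (qᵗ - 1).
  record PseudoregulusType (q t n : ℕ) (L : PointSet) (U : K-Subspace) : Set (suc ℓ) where
    field
      definedBy : L ≐ L[ U ]
      rank      : HasDim U (t ℕ.* n)
      scattered : Scattered U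

      m          : ℕ
      m≡         : m ℕ.* (q ^ t ∸ 1) ≡ q ^ (n ℕ.* t) ∸ 1
      s          : Fin m → Subspace
      s-line     : ∀ i → HasDim (s i) 2
      s-weight   : ∀ i → HasWeight U (s i) t
      s-disjoint : ∀ i j → i ≢ j → Disjoint (s i) (s j)

    Transversal : Subspace → Set ℓ
    Transversal T = HasDim T n × DisjointFrom T L × (∀ i → Meets T (s i))

    field
      T₁ T₂          : Subspace
      T₁-transversal : Transversal T₁
      T₂-transversal : Transversal T₂
      T₁≢T₂          : ¬ T₁ ≐ₛ T₂
      only-T₁-T₂     : ∀ T → Transversal T → T ≐ₛ T₁ ⊎ T ≐ₛ T₂

    pseudoregulus : Pred Subspace ℓ
    pseudoregulus X = ∃ λ i → X ≐ₛ s i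

  module SemilinearMap
    (U₁ U₂ : Subspace)
    (σ : CommutativeRing.Carrier F → CommutativeRing.Carrier F)
    (f : LeftModule.Carrierᴹ (asModule U₁) → LeftModule.Carrierᴹ (asModule U₂))
    (semilinear : IsSemilinear σ (asModule U₁) (asModule U₂) f)
    (bijective : Bijective (LeftModule._≈ᴹ_ (asModule U₁)) (LeftModule._≈ᴹ_ (asModule U₂)) f)
    (fixed : HasFixedField {K = K} {F = F} ι σ)
    where

    private
      module F = CommutativeRing F
      module ι = RingHomomorphism ι
      module U₁ = LeftModule (asModule U₁)
      module U₂ = LeftModule (asModule U₂)
    open V using (_+ᴹ_; _*ₗ_)
    open IsSemilinear semilinear

    private
      f0≈0 : f U₁.0ᴹ U₂.≈ᴹ U₂.0ᴹ
      f0≈0 = identityˡ-unique (proj₁ (f U₁.0ᴹ)) (proj₁ (f U₁.0ᴹ)) (begin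
        proj₁ (f U₁.0ᴹ) +ᴹ proj₁ (f U₁.0ᴹ)  ≈⟨ additive U₁.0ᴹ U₁.0ᴹ ⟨
        proj₁ (f (U₁.0ᴹ U₁.+ᴹ U₁.0ᴹ))       ≈⟨ cong {U₁.0ᴹ U₁.+ᴹ U₁.0ᴹ} {U₁.0ᴹ}
                                                    (U₁.+ᴹ-identityˡ U₁.0ᴹ) ⟩
        proj₁ (f U₁.0ᴹ)                     ∎)
        where
        open SetoidReasoning V.≈ᴹ-setoid
        open GroupProperties V.+ᴹ-group using (identityˡ-unique)

    -- The collineation induced by f from PG(U₁) to PG(U₂).
    Φ : Point U₁ → Point U₂
    Φ P = record
      { vec   = proj₁ (f u)
      ; vec∈  = proj₂ (f u)
      ; vec≉0 = λ fu≈0 → Point.vec≉0 P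
          (proj₁ bijective {u} {U₁.0ᴹ} (V.≈ᴹ-trans fu≈0 (V.≈ᴹ-sym f0≈0)))
      }
      where
      u : U₁.Carrierᴹ
      u = Point.vec P , Point.vec∈ P

    Φ-cong : ∀ P Q → ⟪ P ⟫ ≐ₛ ⟪ Q ⟫ → ⟪ Φ P ⟫ ≐ₛ ⟪ Φ Q ⟫
    Φ-cong P Q (P⊆Q , Q⊆P) =
      image⊆ P Q (P⊆Q (self P)) , image⊆ Q P (Q⊆P (self Q))
      where
      self : ∀ R → Point.vec R ∈ₛ ⟪ R ⟫
      self R = F.1# , V.≈ᴹ-sym (V.*ₗ-identityˡ _)

      image⊆ : ∀ R S → Point.vec R ∈ₛ ⟪ S ⟫ →
                    ∀ {v} → v ∈ₛ ⟪ Φ R ⟫ → v ∈ₛ ⟪ Φ S ⟫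
      image⊆ R S (c , eq) (d , eq′) = d F.* σ c , (begin
        _                                  ≈⟨ eq′ ⟩
        d *ₗ proj₁ (f r)                   ≈⟨ V.*ₗ-congˡ (cong {r} {c U₁.*ₗ s} eq) ⟩
        d *ₗ proj₁ (f (c U₁.*ₗ s))         ≈⟨ V.*ₗ-congˡ (σ-homogeneous c s) ⟩
        d *ₗ (σ c *ₗ proj₁ (f s))          ≈⟨ V.*ₗ-assoc d (σ c) _ ⟨
        (d F.* σ c) *ₗ proj₁ (f s)         ∎)
        where
        open SetoidReasoning V.≈ᴹ-setoid
        r s : U₁.Carrierᴹ
        r = Point.vec R , Point.vec∈ R
        s = Point.vec S , Point.vec∈ S

    linesJoiningCorrespondingPoints : Pred Subspace ℓ
    linesJoiningCorrespondingPoints X =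
      ∃ λ (P : Point U₁) → X ≐ₛ ⟪ P ⟫ ∨ ⟪ Φ P ⟫

    ℒ : F.Carrier → PointSet
    ℒ ρ P = ∃ λ (u : U₁.Carrierᴹ) →
      ¬ proj₁ u ≈ᴹ 0ᴹ × ⟪ P ⟫ ≐ₛ ⟨ proj₁ u +ᴹ ρ *ₗ proj₁ (f u) ⟩

    W : F.Carrier → K-Subspace
    W ρ = record
      { Mem      = λ v → ∃ λ (u : U₁.Carrierᴹ) → v ≈ᴹ graph u
      ; resp     = λ { e (u , eq) → u , V.≈ᴹ-trans (V.≈ᴹ-sym e) eq }
      ; 0∈       = U₁.0ᴹ , V.≈ᴹ-sym (graph0≈0)
      ; +-closed = λ { (u , eq) (v , eq′) → u U₁.+ᴹ v ,
                       V.≈ᴹ-trans (V.+ᴹ-cong eq eq′) (V.≈ᴹ-sym (graph-+ u v)) }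
      ; *-closed = λ { k (u , eq) → ι.⟦ k ⟧ U₁.*ₗ u ,
                       V.≈ᴹ-trans (V.*ₗ-congˡ eq) (V.≈ᴹ-sym (graph-* k u)) }
      }
      where
      open SetoidReasoning V.≈ᴹ-setoid

      graph : U₁.Carrierᴹ → Carrierᴹ
      graph u = proj₁ u +ᴹ ρ *ₗ proj₁ (f u)

      graph0≈0 : graph U₁.0ᴹ ≈ᴹ 0ᴹ
      graph0≈0 = begin
        0ᴹ +ᴹ ρ *ₗ proj₁ (f U₁.0ᴹ)  ≈⟨ V.+ᴹ-identityˡ _ ⟩
        ρ *ₗ proj₁ (f U₁.0ᴹ)        ≈⟨ V.*ₗ-congˡ f0≈0 ⟩
        ρ *ₗ 0ᴹ                     ≈⟨ V.*ₗ-zeroʳ ρ ⟩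
        0ᴹ                          ∎

      graph-+ : ∀ u v → graph (u U₁.+ᴹ v) ≈ᴹ graph u +ᴹ graph v
      graph-+ u v = begin
        (proj₁ u +ᴹ proj₁ v) +ᴹ ρ *ₗ proj₁ (f (u U₁.+ᴹ v))
          ≈⟨ V.+ᴹ-congˡ (V.*ₗ-congˡ (additive u v)) ⟩
        (proj₁ u +ᴹ proj₁ v) +ᴹ ρ *ₗ (proj₁ (f u) +ᴹ proj₁ (f v))
          ≈⟨ V.+ᴹ-congˡ (V.*ₗ-distribˡ ρ _ _) ⟩
        (proj₁ u +ᴹ proj₁ v) +ᴹ (ρ *ₗ proj₁ (f u) +ᴹ ρ *ₗ proj₁ (f v))
          ≈⟨ +ᴹ-interchange _ _ _ _ ⟩
        graph u +ᴹ graph v ∎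
        where
        open CommutativeSemigroupProperties
          (CommutativeMonoid.commutativeSemigroup V.+ᴹ-commutativeMonoid)
          using () renaming (interchange to +ᴹ-interchange)

      graph-* : ∀ k u → graph (ι.⟦ k ⟧ U₁.*ₗ u) ≈ᴹ ι.⟦ k ⟧ *ₗ graph u
      graph-* k u = begin
        κ *ₗ proj₁ u +ᴹ ρ *ₗ proj₁ (f (κ U₁.*ₗ u))
          ≈⟨ V.+ᴹ-congˡ (V.*ₗ-congˡ (σ-homogeneous κ u)) ⟩
        κ *ₗ proj₁ u +ᴹ ρ *ₗ (σ κ *ₗ proj₁ (f u))
          ≈⟨ V.+ᴹ-congˡ (V.*ₗ-congˡ (V.*ₗ-congʳ σκ≈κ)) ⟩
        κ *ₗ proj₁ u +ᴹ ρ *ₗ (κ *ₗ proj₁ (f u))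
          ≈⟨ V.+ᴹ-congˡ (V.*ₗ-assoc ρ κ _) ⟨
        κ *ₗ proj₁ u +ᴹ (ρ F.* κ) *ₗ proj₁ (f u)
          ≈⟨ V.+ᴹ-congˡ (V.*ₗ-congʳ (F.*-comm ρ κ)) ⟩
        κ *ₗ proj₁ u +ᴹ (κ F.* ρ) *ₗ proj₁ (f u)
          ≈⟨ V.+ᴹ-congˡ (V.*ₗ-assoc κ ρ _) ⟩
        κ *ₗ proj₁ u +ᴹ κ *ₗ (ρ *ₗ proj₁ (f u))
          ≈⟨ V.*ₗ-distribˡ κ _ _ ⟨
        κ *ₗ graph u ∎
        where
        κ : F.Carrier
        κ = ι.⟦ k ⟧
        σκ≈κ : σ κ F.≈ κ
        σκ≈κ = Equivalence.from (fixed κ) (k , F.refl)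

{-# OPTIONS --safe #-}

-- Uniqueness of the transversals.  Let T have dimension n and meet every line ⟨u, f u⟩.  These
-- lines are pairwise disjoint and as numerous as the points of T, so each point of T lies on
-- exactly one of them and each line meets T in a single point.  Hence x + y ∈ T with x ∈ U₁,
-- y ∈ U₂ and x ≠ 0 forces y = μ f x.  If μ ≠ 0 and x′ + μ′ f x′ is a second vector of T with x, x′
-- independent, then applying this to λ (x + μ f x) + (x′ + μ′ f x′) for all λ gives
-- λ μ = μ′ σ λ, so σ = 1, contradicting Fix σ = 𝔽_q with t ≥ 2.  So a mixed vector would make T
-- one-dimensional; as n ≥ 2 there is none, and T lies in U₁ or in U₂.
-- The weights are found by counting: the graph map u ↦ u + ρ f u is 𝔽_q-linear and injective, and
-- an 𝔽_q-space with qᵈ elements has dimension d.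
module Submission where

open import Defs
open import Level using (Level)
open import Algebra.Bundles using (CommutativeRing; CommutativeMonoid)
open import Algebra.Module.Bundles using (LeftModule)
open import Algebra.Morphism.Bundles using (RingHomomorphism)
open import Algebra.Morphism.Structures using (module RingMorphisms)
import Algebra.Module.Construct.TensorUnit as TensorUnit
import Algebra.Properties.AbelianGroup as AbelianGroupProperties
import Algebra.Properties.CommutativeMonoid.Sum as CommutativeMonoidSum
import Algebra.Properties.CommutativeSemigroup as CommutativeSemigroupProperties
open import Data.Fin as Fin using (Fin; zero; suc; combine; funToFin; finToFun; splitAt; join; punchOut)
open import Data.Fin.Properties
  using (any?; ¬∀⟶∃¬; injective⇒≤; funToFin-finToFin; finToFun-funToFin; join-splitAt; splitAt-join;
         punchOut-injective)
open import Data.Nat as ℕ using (ℕ; zero; suc; _≤_; _<_; _∸_; _^_; s≤s)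
open import Data.Nat.Properties as ℕₚ
  using (<⇒≤; <⇒≱; ^-*-assoc; ^-identityʳ; ≤-refl; n<1+n; ^-monoʳ-<; 1+n≰n; m+n∸n≡m)
open import Data.Nat.Solver using (module +-*-Solver)
open import Data.Product using (∃; Σ; _×_; _,_; proj₁; proj₂)
open import Data.Sum using (_⊎_; inj₁; inj₂; [_,_]′)
open import Data.Empty using (⊥; ⊥-elim)
open import Data.Vec.Functional using (Vector; _∷_; tail)
open import Data.Vec.Functional.Relation.Binary.Pointwise.Properties
  using () renaming (setoid to vectorSetoid)
open import Function.Base using (_∘_)
open import Function.Bundles using (Inverse; Equivalence)
open import Function.Construct.Composition using () renaming (inverse to inverse-∘)
open import Function.Definitions using (Bijective; Injective)
open import Relation.Binary.Bundles using (Setoid)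
open import Relation.Binary.Definitions using (_Respects_; Decidable)
open import Relation.Binary.PropositionalEquality as ≡ using (_≡_; _≢_; refl; cong; cong₂)
import Relation.Binary.Reasoning.Setoid as SetoidReasoning
open import Relation.Nullary using (¬_; Dec; yes; no; contradiction; map′; decidable-stable)
open import Relation.Unary as Unary using (Pred; _≐_)

private
  variable
    ℓ : Level

-- Pigeonhole and the geometric sum

-- If `y` were missed, punching it out of the codomain would leave an injection from `Fin (suc m)`
-- into `Fin m`.
injective⇒surjective : ∀ {m} (g : Fin m → Fin m) → Injective _≡_ _≡_ g → ∀ y → ∃ λ x → g x ≡ y
injective⇒surjective {suc m} g inj y with any? (λ x → g x Fin.≟ y)
... | yes hit = hit
... | no miss = contradiction (injective⇒≤ punched-injective) 1+n≰n
  where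
  y≢g : ∀ x → ¬ y ≡ g x
  y≢g x eq = miss (x , ≡.sym eq)
  punched-injective : Injective _≡_ _≡_ (λ x → punchOut (y≢g x))
  punched-injective {i} {j} = inj ∘ punchOut-injective (y≢g i) (y≢g j)

funToFin-cong : ∀ {m n} {f g : Fin m → Fin n} → (∀ i → f i ≡ g i) → funToFin f ≡ funToFin g
funToFin-cong {zero}  f≗g = refl
funToFin-cong {suc m} f≗g = cong₂ combine (f≗g zero) (funToFin-cong (f≗g ∘ suc))

-- The sum of `Q ^ i` over `i < n`, the number of points of PG(n - 1, Q). The recursion splits off
-- the affine part, where the leading coordinate can be scaled to 1, from the hyperplane where it
-- vanishes; `normalised` follows the same split.
pointCount : ℕ → ℕ → ℕ
pointCount Q zero    = 0
pointCount Q (suc n) = Q ^ n ℕ.+ pointCount Q n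

pointCount-* : ∀ Q .{{_ : ℕ.NonZero Q}} n → pointCount Q n ℕ.* (Q ∸ 1) ≡ Q ^ n ∸ 1
pointCount-* (suc p) n = ≡.trans (≡.sym (m+n∸n≡m _ 1)) (cong (_∸ 1) (geometric n))
  where
  open +-*-Solver
  -- With the 1 on the left-hand side, and `p` in place of `Q ∸ 1`, the induction is free of
  -- truncated subtraction.
  geometric : ∀ n → pointCount (suc p) n ℕ.* p ℕ.+ 1 ≡ suc p ^ n
  geometric zero    = refl
  geometric (suc n) = ≡.trans
    (solve 3 (λ p x c → (x :+ c) :* p :+ con 1 := x :* p :+ (c :* p :+ con 1)) refl
      p (suc p ^ n) (pointCount (suc p) n))
    (≡.trans (cong (suc p ^ n ℕ.* p ℕ.+_) (geometric n))
      (solve 2 (λ p x → x :* p :+ x := (con 1 :+ p) :* x) refl p (suc p ^ n)))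

-- Finite setoids: decidability, search and comparison of sizes

Enumeration : Setoid ℓ ℓ → ℕ → Set ℓ
Enumeration S N = Inverse (≡.setoid (Fin N)) S

module Enumerated {S : Setoid ℓ ℓ} {N : ℕ} (enum : Enumeration S N) where
  open Setoid S
  open Inverse enum public
    using (to; from; from-cong) renaming (strictlyInverseˡ to to-from; strictlyInverseʳ to from-to)

  from-injective : ∀ {x y} → from x ≡ from y → x ≈ y
  from-injective {x} {y} eq =
    trans (sym (to-from x)) (trans (Inverse.to-cong enum eq) (to-from y))

  to-injective : Injective _≡_ _≈_ to
  to-injective {i} {j} eq =
    ≡.trans (≡.sym (from-to i)) (≡.trans (from-cong eq) (from-to j))

  infix 4 _≟_
  _≟_ : Decidable _≈_
  x ≟ y = map′ from-injective from-cong (from x Fin.≟ from y)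

  search : {P : Pred Carrier ℓ} → P Respects _≈_ → Unary.Decidable P → Dec (∃ P)
  search {P} resp P? = map′
    (λ { (i , p) → to i , p })
    (λ { (x , p) → from x , resp (sym (to-from x)) p })
    (any? (P? ∘ to))

  counterexample : {P : Pred Carrier ℓ} → P Respects _≈_ → Unary.Decidable P →
                   ¬ (∀ x → P x) → ∃ λ x → ¬ P x
  counterexample {P} resp P? ¬all
    with i , ¬p ← ¬∀⟶∃¬ N (P ∘ to) (P? ∘ to) (λ all → ¬all λ x → resp (to-from x) (all (from x)))
    = to i , ¬p

module _ {S T : Setoid ℓ ℓ} {M N : ℕ} (S-enum : Enumeration S M) (T-enum : Enumeration T N) where
  private
    module S = Setoid S
    module T = Setoid T
    module Sₑ = Enumerated S-enum
    module Tₑ = Enumerated T-enum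

  injection⇒≤ : (g : S.Carrier → T.Carrier) → Injective S._≈_ T._≈_ g → M ≤ N
  injection⇒≤ g inj =
    injective⇒≤ {f = Tₑ.from ∘ g ∘ Sₑ.to} (Sₑ.to-injective ∘ inj ∘ Tₑ.from-injective)

vectorEnumeration : {S : Setoid ℓ ℓ} {N : ℕ} → Enumeration S N → ∀ n →
                    Enumeration (vectorSetoid S n) (N ^ n)
vectorEnumeration {S = S} {N} enum n = record
  { to        = λ k → to ∘ finToFun k
  ; from      = λ v → funToFin (from ∘ v)
  ; to-cong   = λ { refl i → S.refl }
  ; from-cong = λ eq → funToFin-cong (λ i → from-cong (eq i))
  ; inverse   = (λ { refl i → S.trans (S.reflexive (cong to (finToFun-funToFin _ i))) (to-from _) })
              , (λ eq → ≡.trans (funToFin-cong (λ i → ≡.trans (from-cong (eq i)) (from-to _)))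
                                (funToFin-finToFin {n} {N} _))
  }
  where
  module S = Setoid S
  open Enumerated enum

-- Finite fields and normalised coordinate vectors

module FiniteField {F : CommutativeRing ℓ ℓ} {Q : ℕ} (finite : IsFiniteField F Q) where
  open CommutativeRing F hiding (zero) renaming (refl to ≈-refl; sym to ≈-sym; trans to ≈-trans)
  open IsFiniteField finite public using (enumeration)
  open IsField (IsFiniteField.isField finite) public
  open Enumerated enumeration public using (_≟_; search; counterexample)

  1<order : 1 < Q
  1<order = injective⇒≤ {f = g} g-injective
    where
    open Enumerated enumeration using (from; from-injective)
    g : Fin 2 → Fin Q
    g zero    = from 0#
    g (suc _) = from 1#
    g-injective : Injective _≡_ _≡_ g
    g-injective {zero}     {zero}     _  = refl
    g-injective {zero}     {suc zero} eq = contradiction (≈-sym (from-injective eq)) 1≉0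
    g-injective {suc zero} {zero}     eq = contradiction (from-injective eq) 1≉0
    g-injective {suc zero} {suc zero} _  = refl

  -- Representatives of the points of PG(n - 1, F): the vectors whose first nonzero entry is 1.
  normalised⊎ : ∀ n → Fin (Q ^ n) ⊎ Fin (pointCount Q n) → Vector Carrier (suc n)
  normalised : ∀ n → Fin (pointCount Q n) → Vector Carrier n
  normalised (suc n) i = normalised⊎ n (splitAt (Q ^ n) i)
  normalised⊎ n (inj₁ j) = 1# ∷ Enumerated.to (vectorEnumeration enumeration n) j
  normalised⊎ n (inj₂ i) = 0# ∷ normalised n i

  private
    module Vectors n = Enumerated (vectorEnumeration enumeration n)

  normalised≉0 : ∀ n i → ¬ (∀ k → normalised n i k ≈ 0#)
  normalised⊎≉0 : ∀ n x → ¬ (∀ k → normalised⊎ n x k ≈ 0#)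
  normalised≉0 (suc n) i = normalised⊎≉0 n (splitAt (Q ^ n) i)
  normalised⊎≉0 n (inj₁ j) eq = 1≉0 (eq zero)
  normalised⊎≉0 n (inj₂ i) eq = normalised≉0 n i (eq ∘ suc)

  -- The leading entries decide. Two ones force `a` to be 1; a one against a zero makes either 1 or
  -- a whole normalised vector vanish; for two zeros the claim passes to the tails.
  normalised-unique : ∀ n i j {a} → (∀ k → normalised n i k ≈ a * normalised n j k) → i ≡ j
  normalised⊎-unique : ∀ n x y {a} → (∀ k → normalised⊎ n x k ≈ a * normalised⊎ n y k) → x ≡ y
  normalised-unique (suc n) i j eq = begin
    i               ≡⟨ join-splitAt (Q ^ n) _ i ⟨
    join _ _ (split i)  ≡⟨ cong (join _ _) (normalised⊎-unique n (split i) (split j) eq) ⟩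
    join _ _ (split j)  ≡⟨ join-splitAt (Q ^ n) _ j ⟩
    j               ∎
    where
    open ≡.≡-Reasoning
    split : Fin (pointCount Q (suc n)) → Fin (Q ^ n) ⊎ Fin (pointCount Q n)
    split = splitAt (Q ^ n)
  normalised⊎-unique n (inj₁ i) (inj₁ j) {a} eq = cong inj₁ (Vectors.to-injective n λ k →
    ≈-trans (eq (suc k)) (≈-trans (*-congʳ a≈1) (*-identityˡ _)))
    where
    a≈1 : a ≈ 1#
    a≈1 = ≈-sym (≈-trans (eq zero) (*-identityʳ a))
  normalised⊎-unique n (inj₁ i) (inj₂ j) {a} eq = contradiction (≈-trans (eq zero) (zeroʳ a)) 1≉0
  normalised⊎-unique n (inj₂ i) (inj₁ j) {a} eq = contradiction
    (λ k → ≈-trans (eq (suc k)) (≈-trans (*-congʳ a≈0) (zeroˡ _))) (normalised≉0 n i)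
    where
    a≈0 : a ≈ 0#
    a≈0 = ≈-sym (≈-trans (eq zero) (*-identityʳ a))
  normalised⊎-unique n (inj₂ i) (inj₂ j) eq = cong inj₂ (normalised-unique n i j (eq ∘ suc))

  -- The scalar is the first nonzero entry of `c`; multiplying the later entries by its inverse
  -- gives the representative.
  normalise : ∀ n (c : Vector Carrier n) → ¬ (∀ k → c k ≈ 0#) →
              ∃ λ i → ∃ λ a → ∀ k → c k ≈ a * normalised n i k
  normalise zero    c c≉0 = contradiction (λ ()) c≉0
  normalise (suc n) c c≉0 with c zero ≟ 0#
  ... | yes c₀≈0 with i , a , eq ← normalise n (tail c) (λ eq → c≉0 λ { zero → c₀≈0 ; (suc k) → eq k })
      = join _ _ x , a , coordinates
      where
      x : Fin (Q ^ n) ⊎ Fin (pointCount Q n)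
      x = inj₂ i
      coordinates : ∀ k → c k ≈ a * normalised (suc n) (join _ _ x) k
      coordinates k rewrite splitAt-join (Q ^ n) _ x with k
      ... | zero  = ≈-trans c₀≈0 (≈-sym (zeroʳ a))
      ... | suc l = eq l
  ... | no c₀≉0 with b , inv ← inverse (c zero) c₀≉0 = join _ _ x , c zero , coordinates
      where
      x : Fin (Q ^ n) ⊎ Fin (pointCount Q n)
      x = inj₁ (Vectors.from n (λ k → b * c (suc k)))
      coordinates : ∀ k → c k ≈ c zero * normalised (suc n) (join _ _ x) k
      coordinates k rewrite splitAt-join (Q ^ n) (pointCount Q n) x with k
      ... | zero  = ≈-sym (*-identityʳ _)
      ... | suc l = begin
        c (suc l)                       ≈⟨ *-identityˡ _ ⟨
        1# * c (suc l)                  ≈⟨ *-congʳ inv ⟨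
        (c zero * b) * c (suc l)        ≈⟨ *-assoc _ _ _ ⟩
        c zero * (b * c (suc l))        ≈⟨ *-congˡ (Vectors.to-from n _ l) ⟨
        c zero * _                      ∎
        where open SetoidReasoning setoid

-- Linear combinations, coordinates and dimension

module Combinations (R : CommutativeRing ℓ ℓ) (M : LeftModule (CommutativeRing.ring R) ℓ ℓ) where
  open CommutativeRing R using (Carrier; _≈_; 0#; _+_; _*_; -_)
  open LeftModule M
  open CommutativeMonoidSum +ᴹ-commutativeMonoid using (sum; sum-cong-≋; ∑-distrib-+; sum-replicate-zero)
  open SetoidReasoning ≈ᴹ-setoid
  private
    module R = CommutativeRing R
    module +ᴹ = AbelianGroupProperties +ᴹ-abelianGroup
    variable
      d : ℕ

  combination : Vector Carrierᴹ d → Vector Carrier d → Carrierᴹ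
  combination b c = sum (λ i → c i *ₗ b i)

  module _ (b : Vector Carrierᴹ d) where

    combination-cong : ∀ {c c′} → (∀ i → c i ≈ c′ i) → combination b c ≈ᴹ combination b c′
    combination-cong eq = sum-cong-≋ (λ i → *ₗ-congʳ (eq i))

    combination-+ : ∀ c c′ → combination b (λ i → c i + c′ i) ≈ᴹ combination b c +ᴹ combination b c′
    combination-+ c c′ = ≈ᴹ-trans (sum-cong-≋ (λ i → *ₗ-distribʳ (b i) (c i) (c′ i)))
      (∑-distrib-+ (λ i → c i *ₗ b i) (λ i → c′ i *ₗ b i))

    combination-0 : combination b (λ _ → 0#) ≈ᴹ 0ᴹ
    combination-0 = ≈ᴹ-trans (sum-cong-≋ (λ i → *ₗ-zeroˡ (b i))) (sum-replicate-zero d)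

  combination-* : ∀ (b : Vector Carrierᴹ d) a c →
                  combination b (λ i → a * c i) ≈ᴹ a *ₗ combination b c
  combination-* {zero}  b a c = ≈ᴹ-sym (*ₗ-zeroʳ a)
  combination-* {suc d} b a c = ≈ᴹ-trans
    (+ᴹ-cong (*ₗ-assoc a _ _) (combination-* (tail b) a (tail c))) (≈ᴹ-sym (*ₗ-distribˡ a _ _))

  combination∈ : (U : Submodule M) (b : Vector Carrierᴹ d) → (∀ i → b i ∈ₛ U) →
                 ∀ c → combination b c ∈ₛ U
  combination∈ {zero}  U b b∈U c = Submodule.0∈ U
  combination∈ {suc d} U b b∈U c = Submodule.+-closed U
    (Submodule.*-closed U (c zero) (b∈U zero)) (combination∈ U (tail b) (b∈U ∘ suc) (tail c))

  Independent : Vector Carrierᴹ d → Set ℓ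
  Independent b = ∀ c → combination b c ≈ᴹ 0ᴹ → ∀ i → c i ≈ 0#

  -*≈- : ∀ a v → (- a) *ₗ v ≈ᴹ -ᴹ (a *ₗ v)
  -*≈- a v = +ᴹ.inverseˡ-unique _ _ (begin
    (- a) *ₗ v +ᴹ a *ₗ v  ≈⟨ *ₗ-distribʳ v _ _ ⟨
    (- a + a) *ₗ v        ≈⟨ *ₗ-congʳ (R.-‿inverseˡ a) ⟩
    0# *ₗ v               ≈⟨ *ₗ-zeroˡ v ⟩
    0ᴹ                    ∎)

  combination-neg : (b : Vector Carrierᴹ d) → ∀ c →
                    combination b (λ i → - c i) ≈ᴹ -ᴹ combination b c
  combination-neg b c = +ᴹ.inverseˡ-unique _ _ (begin
    combination b (λ i → - c i) +ᴹ combination b c   ≈⟨ combination-+ b (λ i → - c i) c ⟨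
    combination b (λ i → - c i + c i)                ≈⟨ combination-cong b (λ i → R.-‿inverseˡ (c i)) ⟩
    combination b (λ _ → 0#)                         ≈⟨ combination-0 b ⟩
    0ᴹ                                               ∎)

  combination-injective : (b : Vector Carrierᴹ d) → Independent b → ∀ {c c′} →
                          combination b c ≈ᴹ combination b c′ → ∀ i → c i ≈ c′ i
  combination-injective b independent {c} {c′} eq i =
    x∙y⁻¹≈ε⇒x≈y _ _ (independent (λ i → c i + - c′ i) (begin
      combination b (λ i → c i + - c′ i)
        ≈⟨ combination-+ b c (λ i → - c′ i) ⟩
      combination b c +ᴹ combination b (λ i → - c′ i)
        ≈⟨ +ᴹ-cong eq (combination-neg b c′) ⟩
      combination b c′ +ᴹ -ᴹ combination b c′
        ≈⟨ -ᴹ‿inverseʳ _ ⟩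
      0ᴹ ∎) i)
    where open AbelianGroupProperties R.+-abelianGroup using (x∙y⁻¹≈ε⇒x≈y)

  coordinates : {U : Submodule M} {n : ℕ} → HasDim U n →
                Inverse (vectorSetoid R.setoid n) (LeftModule.≈ᴹ-setoid (asModule U))
  coordinates {U} dim = record
    { to        = λ c → combination basis c , combination∈ U basis basis∈ c
    ; from      = λ v → proj₁ (spanning (proj₂ v))
    ; to-cong   = combination-cong basis
    ; from-cong = λ {v} {w} eq → combination-injective basis independent
        (≈ᴹ-trans (≈ᴹ-sym (proj₂ (spanning (proj₂ v)))) (≈ᴹ-trans eq (proj₂ (spanning (proj₂ w)))))
    ; inverse   =
        (λ {v} eq → ≈ᴹ-trans (combination-cong basis eq) (≈ᴹ-sym (proj₂ (spanning (proj₂ v)))))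
      , (λ {c} {v} eq → combination-injective basis independent
          (≈ᴹ-trans (≈ᴹ-sym (proj₂ (spanning (proj₂ v)))) eq))
    }
    where open HasDim dim

-- A module over a field with q elements that has qᵈ elements has dimension d: a family of
-- k < d vectors spans at most qᵏ < qᵈ of them, so an independent family can be extended up to d
-- vectors, and no further.
module Counting {K : CommutativeRing ℓ ℓ} {q : ℕ} (finite : IsFiniteField K q)
                (M : LeftModule (CommutativeRing.ring K) ℓ ℓ) (d : ℕ)
                (M-enum : Enumeration (LeftModule.≈ᴹ-setoid M) (q ^ d)) where
  open CommutativeRing K using (Carrier; 0#; 1#; _*_; -_) renaming (trans to ≈-trans)
  open LeftModule M
  open Combinations K M
  open SetoidReasoning ≈ᴹ-setoid
  private
    module K = FiniteField finite
    module +ᴹ = AbelianGroupProperties +ᴹ-abelianGroup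
    module Mₑ = Enumerated M-enum
    variable
      k : ℕ

    vectors : ∀ k → Enumeration (vectorSetoid (CommutativeRing.setoid K) k) (q ^ k)
    vectors = vectorEnumeration K.enumeration

  Spans : Vector Carrierᴹ k → Pred Carrierᴹ ℓ
  Spans b v = ∃ λ c → v ≈ᴹ combination b c

  Spans-resp : (b : Vector Carrierᴹ k) → Spans b Respects _≈ᴹ_
  Spans-resp b v≈w (c , eq) = c , ≈ᴹ-trans (≈ᴹ-sym v≈w) eq

  Spans? : (b : Vector Carrierᴹ k) → Unary.Decidable (Spans b)
  Spans? {k} b v = Enumerated.search (vectors k)
    (λ c≈c′ eq → ≈ᴹ-trans eq (combination-cong b c≈c′)) (λ c → v Mₑ.≟ combination b c)

  independent⇒≤ : (b : Vector Carrierᴹ k) → Independent b → q ^ k ≤ q ^ d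
  independent⇒≤ {k} b independent =
    injection⇒≤ (vectors k) M-enum (combination b) (combination-injective b independent)

  spanning⇒≥ : {b : Vector Carrierᴹ k} → (∀ v → Spans b v) → q ^ d ≤ q ^ k
  spanning⇒≥ {k} {b} spans = injection⇒≤ M-enum (vectors k) (proj₁ ∘ spans)
    (λ {v} {w} eq → ≈ᴹ-trans (proj₂ (spans v))
      (≈ᴹ-trans (combination-cong b eq) (≈ᴹ-sym (proj₂ (spans w)))))

  -- A relation with a nonzero coefficient at `v` could be solved for `v`, which would put `v` into
  -- the span of `b`.
  extend : (b : Vector Carrierᴹ k) {v : Carrierᴹ} → Independent b → ¬ Spans b v → Independent (v ∷ b)
  extend b {v} independent v∉ c eq with c zero K.≟ 0#
  ... | yes c₀≈0 = λ { zero → c₀≈0 ; (suc i) → independent (tail c) tail≈0 i }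
    where
    tail≈0 : combination b (tail c) ≈ᴹ 0ᴹ
    tail≈0 = begin
      combination b (tail c)                   ≈⟨ +ᴹ-identityˡ _ ⟨
      0ᴹ +ᴹ combination b (tail c)             ≈⟨ +ᴹ-congʳ (*ₗ-zeroˡ v) ⟨
      0# *ₗ v +ᴹ combination b (tail c)        ≈⟨ +ᴹ-congʳ (*ₗ-congʳ c₀≈0) ⟨
      c zero *ₗ v +ᴹ combination b (tail c)    ≈⟨ eq ⟩
      0ᴹ                                       ∎
  ... | no c₀≉0 with a , inv ← K.inverse (c zero) c₀≉0 =
    contradiction ((λ i → a * - c (suc i)) , spanned) v∉
    where
    spanned : v ≈ᴹ combination b (λ i → a * - c (suc i))
    spanned = begin
      v                                                ≈⟨ *ₗ-identityˡ v ⟨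
      1# *ₗ v                                          ≈⟨ *ₗ-congʳ (≈-trans (CommutativeRing.*-comm K _ _) inv) ⟨
      (a * c zero) *ₗ v                                ≈⟨ *ₗ-assoc _ _ _ ⟩
      a *ₗ (c zero *ₗ v)                               ≈⟨ *ₗ-congˡ (+ᴹ.inverseˡ-unique _ _ eq) ⟩
      a *ₗ (-ᴹ combination b (tail c))                 ≈⟨ *ₗ-congˡ (combination-neg b (tail c)) ⟨
      a *ₗ combination b (λ i → - c (suc i))           ≈⟨ combination-* b _ _ ⟨
      combination b (λ i → a * - c (suc i))            ∎

  independentFamily : ∀ k → k ≤ d → ∃ λ (b : Vector Carrierᴹ k) → Independent b
  independentFamily zero    _   = (λ ()) , λ _ _ ()
  independentFamily (suc k) k<d =
    let b , independent = independentFamily k (<⇒≤ k<d)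
        v , v∉ = Mₑ.counterexample (Spans-resp b) (Spans? b)
                   (<⇒≱ (^-monoʳ-< q K.1<order k<d) ∘ spanning⇒≥)
    in v ∷ b , extend b independent v∉

  dimension : HasDim (full {M = M}) d
  dimension with b , independent ← independentFamily d ≤-refl = record
    { basis       = b
    ; basis∈      = _
    ; independent = independent
    ; spanning    = λ {v} _ → decidable-stable (Spans? b v) λ v∉ →
        <⇒≱ (^-monoʳ-< q K.1<order (n<1+n d)) (independent⇒≤ (v ∷ b) (extend b independent v∉))
    }

module _ (R : CommutativeRing ℓ ℓ) {M N : LeftModule (CommutativeRing.ring R) ℓ ℓ} where
  private
    module M = LeftModule M
    module N = LeftModule N
    open Combinations R using (combination)

  module _ {φ : M.Carrierᴹ → N.Carrierᴹ}
           (φ-+ : ∀ u v → φ (u M.+ᴹ v) N.≈ᴹ φ u N.+ᴹ φ v)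
           (φ-* : ∀ a u → φ (a M.*ₗ u) N.≈ᴹ a N.*ₗ φ u)
           (φ-kernel : ∀ u → φ u N.≈ᴹ N.0ᴹ → u M.≈ᴹ M.0ᴹ)
           (φ-cong : ∀ {u v} → u M.≈ᴹ v → φ u N.≈ᴹ φ v) where

    φ-combination : ∀ {d} (b : Vector M.Carrierᴹ d) c →
                    φ (combination M b c) N.≈ᴹ combination N (φ ∘ b) c
    φ-combination {zero}  b c = N.≈ᴹ-trans (φ-cong (M.≈ᴹ-sym (M.*ₗ-zeroˡ M.0ᴹ)))
      (N.≈ᴹ-trans (φ-* _ _) (N.*ₗ-zeroˡ _))
    φ-combination {suc d} b c = N.≈ᴹ-trans (φ-+ _ _)
      (N.+ᴹ-cong (φ-* _ _) (φ-combination (tail b) (tail c)))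

    -- An injective linear map onto `U` carries a basis to a basis. Ranks and weights inside `V` are
    -- thereby reduced to the dimension of a space whose number of elements is known.
    image-dimension : (U : Submodule N) → (∀ u → φ u ∈ₛ U) →
                      (∀ {v} → v ∈ₛ U → ∃ λ u → v N.≈ᴹ φ u) →
                      ∀ {d} → HasDim (full {M = M}) d → HasDim U d
    image-dimension U φ∈U surjective dim = record
      { basis       = φ ∘ basis
      ; basis∈      = φ∈U ∘ basis
      ; independent = λ c eq → independent c
          (φ-kernel _ (N.≈ᴹ-trans (φ-combination basis c) eq))
      ; spanning    = λ v∈U →
          let u , v≈φu = surjective v∈U
              c , u≈ = spanning {u} _
          in c , N.≈ᴹ-trans v≈φu (N.≈ᴹ-trans (φ-cong u≈) (φ-combination basis c))
      }
      where open HasDim dim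

-- Vector spaces over a finite field: spans, independence and points

module VectorSpace {F : CommutativeRing ℓ ℓ} {Q : ℕ} (finite : IsFiniteField F Q)
                   (V : LeftModule (CommutativeRing.ring F) ℓ ℓ) where
  open CommutativeRing F using (Carrier; _≈_; 0#; 1#; _+_; _*_; -_; *-comm; *-congˡ; *-assoc; *-identityˡ)
    renaming (sym to ≈-sym; trans to ≈-trans)
  open LeftModule V
  open FiniteField finite
  open Combinations F V
  open Submodule
  open SetoidReasoning ≈ᴹ-setoid
  open CommutativeSemigroupProperties
    (CommutativeMonoid.commutativeSemigroup +ᴹ-commutativeMonoid) public
    using () renaming (interchange to +ᴹ-interchange)
  private
    module +ᴹ = AbelianGroupProperties +ᴹ-abelianGroup
    module F = CommutativeRing F

  span : Carrierᴹ → Submodule V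
  span = ⟨_⟩

  unscale : ∀ {a} → ¬ a ≈ 0# → ∃ λ b → ∀ v → b *ₗ (a *ₗ v) ≈ᴹ v
  unscale {a} a≉0 with b , inv ← inverse a a≉0 = b , λ v → begin
    b *ₗ (a *ₗ v)  ≈⟨ *ₗ-assoc b a v ⟨
    (b * a) *ₗ v   ≈⟨ *ₗ-congʳ (≈-trans (*-comm b a) inv) ⟩
    1# *ₗ v        ≈⟨ *ₗ-identityˡ v ⟩
    v              ∎

  scale≈0 : ∀ {a v} → ¬ v ≈ᴹ 0ᴹ → a *ₗ v ≈ᴹ 0ᴹ → a ≈ 0#
  scale≈0 {a} {v} v≉0 eq = decidable-stable (a ≟ 0#) λ a≉0 →
    let b , cancel = unscale a≉0
    in v≉0 (≈ᴹ-trans (≈ᴹ-sym (cancel v)) (≈ᴹ-trans (*ₗ-congˡ eq) (*ₗ-zeroʳ b)))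

  scale≉0 : ∀ {a v} → ¬ a ≈ 0# → ¬ v ≈ᴹ 0ᴹ → ¬ a *ₗ v ≈ᴹ 0ᴹ
  scale≉0 a≉0 v≉0 eq = a≉0 (scale≈0 v≉0 eq)

  *-injective : ∀ {a b c} → ¬ a ≈ 0# → a * b ≈ a * c → b ≈ c
  *-injective {a} {b} {c} a≉0 eq with d , inv ← inverse a a≉0 =
    ≈-trans (≈-sym (cancel b)) (≈-trans (*-congˡ eq) (cancel c))
    where
    cancel : ∀ x → d * (a * x) ≈ x
    cancel x = ≈-trans (≈-sym (*-assoc d a x))
      (≈-trans (F.*-congʳ (≈-trans (*-comm d a) inv)) (*-identityˡ x))

  -- Separates the two kinds of summands: when those on the left and those on the right lie in
  -- subspaces with zero intersection, both sides vanish.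
  exchange : ∀ {u v w x} → u +ᴹ v ≈ᴹ w +ᴹ x → u +ᴹ -ᴹ w ≈ᴹ x +ᴹ -ᴹ v
  exchange {u} {v} {w} {x} eq = begin
    u +ᴹ -ᴹ w                        ≈⟨ +ᴹ-identityʳ _ ⟨
    (u +ᴹ -ᴹ w) +ᴹ 0ᴹ                ≈⟨ +ᴹ-congˡ (-ᴹ‿inverseʳ v) ⟨
    (u +ᴹ -ᴹ w) +ᴹ (v +ᴹ -ᴹ v)       ≈⟨ +ᴹ-interchange _ _ _ _ ⟩
    (u +ᴹ v) +ᴹ (-ᴹ w +ᴹ -ᴹ v)       ≈⟨ +ᴹ-congʳ eq ⟩
    (w +ᴹ x) +ᴹ (-ᴹ w +ᴹ -ᴹ v)       ≈⟨ +ᴹ-interchange _ _ _ _ ⟩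
    (w +ᴹ -ᴹ w) +ᴹ (x +ᴹ -ᴹ v)       ≈⟨ +ᴹ-congʳ (-ᴹ‿inverseʳ w) ⟩
    0ᴹ +ᴹ (x +ᴹ -ᴹ v)                ≈⟨ +ᴹ-identityˡ _ ⟩
    x +ᴹ -ᴹ v                        ∎

  -‿closed : (U : Submodule V) → ∀ {v} → v ∈ₛ U → (-ᴹ v) ∈ₛ U
  -‿closed U v∈U = proj₂ (LeftModule.-ᴹ_ (asModule U) (_ , v∈U))

  +-cancelˡ-∈ : (U : Submodule V) → ∀ {v w} → v ∈ₛ U → (v +ᴹ w) ∈ₛ U → w ∈ₛ U
  +-cancelˡ-∈ U {v} {w} v∈U v+w∈U = resp U (begin
    -ᴹ v +ᴹ (v +ᴹ w)    ≈⟨ +ᴹ-assoc _ _ _ ⟨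
    (-ᴹ v +ᴹ v) +ᴹ w    ≈⟨ +ᴹ-congʳ (-ᴹ‿inverseˡ v) ⟩
    0ᴹ +ᴹ w             ≈⟨ +ᴹ-identityˡ w ⟩
    w                   ∎) (+-closed U (-‿closed U v∈U) v+w∈U)

  *ₗ-difference≈0 : ∀ {a b v} → a *ₗ v ≈ᴹ b *ₗ v → (a + - b) *ₗ v ≈ᴹ 0ᴹ
  *ₗ-difference≈0 {a} {b} {v} eq = begin
    (a + - b) *ₗ v             ≈⟨ *ₗ-distribʳ v a (- b) ⟩
    a *ₗ v +ᴹ (- b) *ₗ v       ≈⟨ +ᴹ-cong eq (-*≈- b v) ⟩
    b *ₗ v +ᴹ -ᴹ (b *ₗ v)      ≈⟨ -ᴹ‿inverseʳ _ ⟩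
    0ᴹ                         ∎

  scalar-unique : ∀ {a b v} → ¬ v ≈ᴹ 0ᴹ → a *ₗ v ≈ᴹ b *ₗ v → a ≈ b
  scalar-unique v≉0 eq = x∙y⁻¹≈ε⇒x≈y _ _ (scale≈0 v≉0 (*ₗ-difference≈0 eq))
    where open AbelianGroupProperties F.+-abelianGroup using (x∙y⁻¹≈ε⇒x≈y)

  generator∈ : ∀ v → v ∈ₛ span v
  generator∈ v = 1# , ≈ᴹ-sym (*ₗ-identityˡ v)

  span-least : (U : Submodule V) → ∀ {v w} → v ∈ₛ U → w ∈ₛ span v → w ∈ₛ U
  span-least U v∈U (c , w≈cv) = resp U (≈ᴹ-sym w≈cv) (*-closed U c v∈U)

  span-resp : ∀ {u v w} → v ≈ᴹ w → u ∈ₛ span v → u ∈ₛ span w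
  span-resp {w = w} v≈w = span-least (span w) (resp (span w) (≈ᴹ-sym v≈w) (generator∈ w))

  span-swap : ∀ {v w} → ¬ v ≈ᴹ 0ᴹ → v ∈ₛ span w → w ∈ₛ span v
  span-swap {v} {w} v≉0 (a , v≈aw) =
    let b , cancel = unscale a≉0 in b , ≈ᴹ-trans (≈ᴹ-sym (cancel w)) (*ₗ-congˡ (≈ᴹ-sym v≈aw))
    where
    a≉0 : ¬ a ≈ 0#
    a≉0 a≈0 = v≉0 (≈ᴹ-trans v≈aw (≈ᴹ-trans (*ₗ-congʳ a≈0) (*ₗ-zeroˡ w)))

  span-common : ∀ {u v w} → ¬ v ≈ᴹ 0ᴹ → u ∈ₛ span w → v ∈ₛ span w → u ∈ₛ span v
  span-common v≉0 u∈ v∈ = span-least (span _) (span-swap v≉0 v∈) u∈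

  span≐ : ∀ {v w} → ¬ v ≈ᴹ 0ᴹ → v ∈ₛ span w → span v ≐ₛ span w
  span≐ v≉0 v∈ = span-least (span _) v∈ , span-least (span _) (span-swap v≉0 v∈)

  -- By `exchange`, `(d - b) w` is a multiple of `v`. Since `w` is not, `d - b` is zero, and then
  -- `a v` equals `c v`.
  coefficients-unique : ∀ {v w a b c d} → ¬ v ≈ᴹ 0ᴹ → ¬ w ∈ₛ span v →
                        a *ₗ v +ᴹ b *ₗ w ≈ᴹ c *ₗ v +ᴹ d *ₗ w → a ≈ c × b ≈ d
  coefficients-unique {v} {w} {a} {b} {c} {d} v≉0 w∉ eq =
    scalar-unique v≉0 (+ᴹ.x∙y⁻¹≈ε⇒x≈y _ _ (≈ᴹ-trans difference
      (≈ᴹ-trans (*ₗ-congʳ d-b≈0) (*ₗ-zeroˡ w)))) ,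
    ≈-sym (x∙y⁻¹≈ε⇒x≈y _ _ d-b≈0)
    where
    open AbelianGroupProperties F.+-abelianGroup using (x∙y⁻¹≈ε⇒x≈y)
    difference : a *ₗ v +ᴹ -ᴹ (c *ₗ v) ≈ᴹ (d + - b) *ₗ w
    difference = begin
      a *ₗ v +ᴹ -ᴹ (c *ₗ v)    ≈⟨ exchange eq ⟩
      d *ₗ w +ᴹ -ᴹ (b *ₗ w)    ≈⟨ +ᴹ-congˡ (-*≈- b w) ⟨
      d *ₗ w +ᴹ (- b) *ₗ w     ≈⟨ *ₗ-distribʳ w d (- b) ⟨
      (d + - b) *ₗ w           ∎
    scaled∈ : ((d + - b) *ₗ w) ∈ₛ span v
    scaled∈ = resp (span v) difference (+-closed (span v) (a , ≈ᴹ-refl)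
      (-‿closed (span v) (c , ≈ᴹ-refl)))
    d-b≈0 : d + - b ≈ 0#
    d-b≈0 = decidable-stable (_ ≟ 0#) λ d-b≉0 →
      let e , cancel = unscale d-b≉0
      in w∉ (resp (span v) (cancel w) (*-closed (span v) e scaled∈))

  enumerate : {U : Submodule V} {n : ℕ} → HasDim U n →
              Enumeration (LeftModule.≈ᴹ-setoid (asModule U)) (Q ^ n)
  enumerate {n = n} dim = inverse-∘ (vectorEnumeration enumeration n) (coordinates dim)

  module _ {U : Submodule V} where
    open HasDim

    basis₀≉0 : ∀ {n} (dim : HasDim U (suc n)) → ¬ basis dim zero ≈ᴹ 0ᴹ
    basis₀≉0 dim eq = 1≉0 (independent dim (1# ∷ λ _ → 0#) (begin
      1# *ₗ basis dim zero +ᴹ combination (tail (basis dim)) (λ _ → 0#)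
        ≈⟨ +ᴹ-cong (≈ᴹ-trans (*ₗ-identityˡ _) eq) (combination-0 (tail (basis dim))) ⟩
      0ᴹ +ᴹ 0ᴹ
        ≈⟨ +ᴹ-identityˡ 0ᴹ ⟩
      0ᴹ ∎) zero)

    nonzero : ∀ {n} → 1 ≤ n → HasDim U n → ∃ λ v → v ∈ₛ U × ¬ v ≈ᴹ 0ᴹ
    nonzero (s≤s _) dim = basis dim zero , basis∈ dim zero , basis₀≉0 dim

    -- Two basis vectors inside one span are proportional, and the factor of proportionality yields
    -- a relation in which the second basis vector has coefficient 1.
    dimension≥2⇒⊈span : ∀ {n} → 2 ≤ n → HasDim U n → ∀ v → ¬ (∀ {w} → w ∈ₛ U → w ∈ₛ span v)
    dimension≥2⇒⊈span (s≤s (s≤s _)) dim v U⊆ with span-common (basis₀≉0 dim)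
      (U⊆ (basis∈ dim (suc zero))) (U⊆ (basis∈ dim zero))
    ... | a , b₁≈ab₀ = 1≉0 (independent dim (- a ∷ (1# ∷ λ _ → 0#)) (begin
      (- a) *ₗ b₀ +ᴹ (1# *ₗ b₁ +ᴹ combination (tail (tail (basis dim))) (λ _ → 0#))
        ≈⟨ +ᴹ-cong (-*≈- a b₀) (+ᴹ-cong (*ₗ-identityˡ b₁) (combination-0 (tail (tail (basis dim))))) ⟩
      -ᴹ (a *ₗ b₀) +ᴹ (b₁ +ᴹ 0ᴹ)
        ≈⟨ +ᴹ-congˡ (≈ᴹ-trans (+ᴹ-identityʳ b₁) b₁≈ab₀) ⟩
      -ᴹ (a *ₗ b₀) +ᴹ a *ₗ b₀
        ≈⟨ -ᴹ‿inverseˡ _ ⟩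
      0ᴹ ∎) (suc zero))
      where
      b₀ = basis dim zero
      b₁ = basis dim (suc zero)

    module Points {n : ℕ} (dim : HasDim U n) where

      point : Fin (pointCount Q n) → Point U
      point i = record
        { vec   = combination (basis dim) (normalised n i)
        ; vec∈  = combination∈ U (basis dim) (basis∈ dim) (normalised n i)
        ; vec≉0 = λ eq → normalised≉0 n i (independent dim (normalised n i) eq)
        }

      point-unique : ∀ i j → Point.vec (point i) ∈ₛ ⟪ point j ⟫ → i ≡ j
      point-unique i j (a , eq) = normalised-unique n i j {a}
        (combination-injective (basis dim) (independent dim)
          (≈ᴹ-trans eq (≈ᴹ-sym (combination-* (basis dim) a (normalised n j)))))

      point-cover : ∀ {v} → v ∈ₛ U → ¬ v ≈ᴹ 0ᴹ → ∃ λ i → v ∈ₛ ⟪ point i ⟫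
      point-cover {v} v∈U v≉0 =
        let c , v≈ = spanning dim v∈U
            i , a , c≈ = normalise n c λ c≈0 → v≉0 (≈ᴹ-trans v≈
              (≈ᴹ-trans (combination-cong (basis dim) c≈0) (combination-0 (basis dim))))
        in i , a , ≈ᴹ-trans v≈ (≈ᴹ-trans (combination-cong (basis dim) c≈)
             (combination-* (basis dim) a (normalised n i)))

-- The direct sum, the automorphism and the semilinear map

module Pseudoregulus
  (q t n : ℕ) (2≤t : 2 ≤ t) (2≤n : 2 ≤ n)
  (K F : CommutativeRing ℓ ℓ) (K-finite : IsFiniteField K q) (F-finite : IsFiniteField F (q ^ t))
  (ι : RingHomomorphism (CommutativeRing.rawRing K) (CommutativeRing.rawRing F))
  (V : LeftModule (CommutativeRing.ring F) ℓ ℓ) (V-dim : HasDim (full {M = V}) (2 ℕ.* n))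
  (U₁ U₂ : Submodule V) (direct : IsDirectSum U₁ U₂) (U₁-dim : HasDim U₁ n) (U₂-dim : HasDim U₂ n)
  (σ : CommutativeRing.Carrier F → CommutativeRing.Carrier F)
  (σ-iso : RingMorphisms.IsRingIsomorphism (CommutativeRing.rawRing F) (CommutativeRing.rawRing F) σ)
  (fixed : HasFixedField {K = K} {F = F} ι σ)
  (f : LeftModule.Carrierᴹ (asModule U₁) → LeftModule.Carrierᴹ (asModule U₂))
  (semilinear : IsSemilinear σ (asModule U₁) (asModule U₂) f)
  (bijective : Bijective (LeftModule._≈ᴹ_ (asModule U₁)) (LeftModule._≈ᴹ_ (asModule U₂)) f)
  (ρ : CommutativeRing.Carrier F) (ρ≉0 : ¬ CommutativeRing._≈_ F ρ (CommutativeRing.0# F))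
  where

  open LinearSets {K = K} {F = F} ι V
  open SemilinearMap U₁ U₂ σ f semilinear bijective fixed
  open CommutativeRing F using (Carrier; _≈_; 0#; 1#; _+_; _*_; *-comm; *-congˡ; *-congʳ)
    renaming (refl to ≈-refl; sym to ≈-sym; trans to ≈-trans)
  open LeftModule V
  open FiniteField F-finite
  open VectorSpace F-finite V
  open Submodule
  open Point using (vec; vec∈; vec≉0)
  open SetoidReasoning ≈ᴹ-setoid
  private
    module F = CommutativeRing F
    module K = CommutativeRing K
    module Kᶠ = FiniteField K-finite
    module ι = RingHomomorphism ι
    module σ = RingMorphisms.IsRingIsomorphism σ-iso
    module U₁ = LeftModule (asModule U₁)
    module U₂ = LeftModule (asModule U₂)
    module f = IsSemilinear semilinear
    module direct = IsDirectSum direct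
    module Vₑ = Enumerated (enumerate V-dim)
    module +ᴹ = AbelianGroupProperties +ᴹ-abelianGroup

  infix 4 _≟ᴹ_
  -- `V` is finite by `V-dim`, so its vectors can be compared; this licenses the later case
  -- distinctions on whether a component is zero.
  _≟ᴹ_ : Decidable _≈ᴹ_
  v ≟ᴹ w = (v , _) Vₑ.≟ (w , _)

  -- After `exchange`, the difference of the first components lies in both `U₁` and `U₂`.
  components-unique : ∀ {x x′ y y′} → x ∈ₛ U₁ → x′ ∈ₛ U₁ → y ∈ₛ U₂ → y′ ∈ₛ U₂ →
                      x +ᴹ y ≈ᴹ x′ +ᴹ y′ → x ≈ᴹ x′ × y ≈ᴹ y′
  components-unique x∈ x′∈ y∈ y′∈ eq =
    +ᴹ.x∙y⁻¹≈ε⇒x≈y _ _ difference≈0 ,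
    ≈ᴹ-sym (+ᴹ.x∙y⁻¹≈ε⇒x≈y _ _ (≈ᴹ-trans (≈ᴹ-sym (exchange eq)) difference≈0))
    where
    difference≈0 = direct.independent (+-closed U₁ x∈ (-‿closed U₁ x′∈))
      (resp U₂ (≈ᴹ-sym (exchange eq)) (+-closed U₂ y′∈ (-‿closed U₂ y∈)))

  components≈0 : ∀ {x y} → x ∈ₛ U₁ → y ∈ₛ U₂ → x +ᴹ y ≈ᴹ 0ᴹ → x ≈ᴹ 0ᴹ × y ≈ᴹ 0ᴹ
  components≈0 x∈ y∈ eq = components-unique x∈ (0∈ U₁) y∈ (0∈ U₂)
    (≈ᴹ-trans eq (≈ᴹ-sym (+ᴹ-identityˡ 0ᴹ)))

  -- If `k` had an inverse, applying `ι` to the product would give 1 = 0 in `F`.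
  ι-injective : ∀ {k} → ι.⟦ k ⟧ ≈ 0# → k K.≈ K.0#
  ι-injective {k} ιk≈0 = decidable-stable (k Kᶠ.≟ K.0#) λ k≉0 →
    let l , inv = Kᶠ.inverse k k≉0 in
    1≉0 (≈-trans (≈-sym ι.1#-homo) (≈-trans (ι.⟦⟧-cong (K.sym inv))
      (≈-trans (ι.*-homo k l) (≈-trans (*-congʳ ιk≈0) (F.zeroˡ _)))))

  -- Were every element fixed, each would have a preimage under `ι`, and choosing one would inject
  -- `F` into `K`. This gives `q ^ t ≤ q`, against `2 ≤ t`.
  moved : ∃ λ a → ¬ σ a ≈ a
  moved = counterexample (λ a≈b σa≈a → ≈-trans (σ.⟦⟧-cong (≈-sym a≈b)) (≈-trans σa≈a a≈b))
    (λ a → σ a ≟ a) λ σ-trivial →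
      let preimage = λ a → Equivalence.to (fixed a) (σ-trivial a) in
      <⇒≱ (^-monoʳ-< q Kᶠ.1<order 2≤t) (≡.subst (q ^ t ≤_) (≡.sym (^-identityʳ q))
        (injection⇒≤ enumeration Kᶠ.enumeration (proj₁ ∘ preimage) λ {a} {b} eq →
          ≈-trans (≈-sym (proj₂ (preimage a))) (≈-trans (ι.⟦⟧-cong eq) (proj₂ (preimage b)))))

  f≈0 : ∀ u → proj₁ u ≈ᴹ 0ᴹ → proj₁ (f u) ≈ᴹ 0ᴹ
  f≈0 u u≈0 = begin
    proj₁ (f u)                 ≈⟨ f.cong (≈ᴹ-trans u≈0 (≈ᴹ-sym (*ₗ-zeroˡ (proj₁ u)))) ⟩
    proj₁ (f (0# U₁.*ₗ u))      ≈⟨ f.σ-homogeneous 0# u ⟩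
    σ 0# *ₗ proj₁ (f u)         ≈⟨ *ₗ-congʳ σ.0#-homo ⟩
    0# *ₗ proj₁ (f u)           ≈⟨ *ₗ-zeroˡ _ ⟩
    0ᴹ                          ∎

  f≉0 : ∀ u → ¬ proj₁ u ≈ᴹ 0ᴹ → ¬ proj₁ (f u) ≈ᴹ 0ᴹ
  f≉0 u u≉0 fu≈0 = u≉0 (proj₁ bijective {u} {U₁.0ᴹ}
    (≈ᴹ-trans fu≈0 (≈ᴹ-sym (f≈0 U₁.0ᴹ ≈ᴹ-refl))))

  f-span : ∀ u u′ → proj₁ u ∈ₛ span (proj₁ u′) → proj₁ (f u) ∈ₛ span (proj₁ (f u′))
  f-span u u′ (a , eq) = σ a , ≈ᴹ-trans (f.cong eq) (f.σ-homogeneous a u′)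

  -- As `σ` is onto, the factor `b` is some `σ a` and can be moved inside `f`; injectivity of `f`
  -- then removes `f`.
  f-span⁻ : ∀ u u′ → proj₁ (f u) ∈ₛ span (proj₁ (f u′)) → proj₁ u ∈ₛ span (proj₁ u′)
  f-span⁻ u u′ (b , eq) with a , σa≈ ← σ.surjective b =
    a , proj₁ bijective {u} {a U₁.*ₗ u′} (begin
      proj₁ (f u)                ≈⟨ eq ⟩
      b *ₗ proj₁ (f u′)          ≈⟨ *ₗ-congʳ (σa≈ ≈-refl) ⟨
      σ a *ₗ proj₁ (f u′)        ≈⟨ f.σ-homogeneous a u′ ⟨
      proj₁ (f (a U₁.*ₗ u′))     ∎)

  -- The linear set: rank and scatteredness

  -- Definitionally the map local to `W`, so membership of `graph u` in `W ρ` is witnessed by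
  -- reflexivity.
  graph : U₁.Carrierᴹ → Carrierᴹ
  graph u = proj₁ u +ᴹ ρ *ₗ proj₁ (f u)

  ρf∈ : ∀ u → (ρ *ₗ proj₁ (f u)) ∈ₛ U₂
  ρf∈ u = *-closed U₂ ρ (proj₂ (f u))

  graph-cong : ∀ {u v} → u U₁.≈ᴹ v → graph u ≈ᴹ graph v
  graph-cong u≈v = +ᴹ-cong u≈v (*ₗ-congˡ (f.cong u≈v))

  graph-+ : ∀ u v → graph (u U₁.+ᴹ v) ≈ᴹ graph u +ᴹ graph v
  graph-+ u v = ≈ᴹ-trans
    (+ᴹ-congˡ (≈ᴹ-trans (*ₗ-congˡ (f.additive u v)) (*ₗ-distribˡ ρ _ _)))
    (+ᴹ-interchange _ _ _ _)

  -- The factor `ρ` stays on the left here and in `*-graph`, so that comparing the two and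
  -- cancelling `ρ` leaves `σ a` against `a`.
  ρf-* : ∀ a u → ρ *ₗ proj₁ (f (a U₁.*ₗ u)) ≈ᴹ (ρ * σ a) *ₗ proj₁ (f u)
  ρf-* a u = ≈ᴹ-trans (*ₗ-congˡ (f.σ-homogeneous a u)) (≈ᴹ-sym (*ₗ-assoc ρ _ _))

  *-graph : ∀ a u → a *ₗ graph u ≈ᴹ a *ₗ proj₁ u +ᴹ (ρ * a) *ₗ proj₁ (f u)
  *-graph a u = ≈ᴹ-trans (*ₗ-distribˡ a _ _) (+ᴹ-congˡ
    (≈ᴹ-trans (≈ᴹ-sym (*ₗ-assoc a ρ _)) (*ₗ-congʳ (*-comm a ρ))))

  -- `σ` fixes the image of `ι`, so for scalars from `K` the twist disappears.
  graph-* : ∀ k u → graph (ι.⟦ k ⟧ U₁.*ₗ u) ≈ᴹ ι.⟦ k ⟧ *ₗ graph u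
  graph-* k u = ≈ᴹ-trans
    (+ᴹ-congˡ (≈ᴹ-trans (ρf-* ι.⟦ k ⟧ u)
      (*ₗ-congʳ (*-congˡ (Equivalence.from (fixed ι.⟦ k ⟧) (k , ≈-refl))))))
    (≈ᴹ-sym (*-graph ι.⟦ k ⟧ u))

  graph≈0 : ∀ u → graph u ≈ᴹ 0ᴹ → proj₁ u ≈ᴹ 0ᴹ
  graph≈0 u eq = proj₁ (components≈0 (proj₂ u) (ρf∈ u) eq)

  graph≉0 : ∀ u → ¬ proj₁ u ≈ᴹ 0ᴹ → ¬ graph u ≈ᴹ 0ᴹ
  graph≉0 u u≉0 eq = u≉0 (graph≈0 u eq)

  ℒ≐L[W] : ℒ ρ ≐ L[ W ρ ]
  ℒ≐L[W] =
    (λ { (u , u≉0 , P≐) → graph u , (u , ≈ᴹ-refl) , graph≉0 u u≉0 , P≐ }) ,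
    (λ { (w , (u , w≈) , w≉0 , P≐) → u ,
         (λ u≈0 → w≉0 (begin
           w                                ≈⟨ w≈ ⟩
           proj₁ u +ᴹ ρ *ₗ proj₁ (f u)      ≈⟨ +ᴹ-cong u≈0 (*ₗ-congˡ (f≈0 u u≈0)) ⟩
           0ᴹ +ᴹ ρ *ₗ 0ᴹ                    ≈⟨ +ᴹ-identityˡ _ ⟩
           ρ *ₗ 0ᴹ                          ≈⟨ *ₗ-zeroʳ ρ ⟩
           0ᴹ                               ∎)) ,
         (λ v∈P → span-resp w≈ (proj₁ P≐ v∈P)) ,
         (λ v∈ → proj₂ P≐ (span-resp (≈ᴹ-sym w≈) v∈)) })

  -- `U₁` has `(q ^ t) ^ n = q ^ (t n)` elements, which gives its dimension over `K`; `graph`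
  -- carries it isomorphically onto `W ρ`.
  W-rank : HasDim (W ρ) (t ℕ.* n)
  W-rank = image-dimension K {M = restrictScalars ι (asModule U₁)} {N = restrictScalars ι V}
    {φ = graph} graph-+ graph-* graph≈0 graph-cong (W ρ) (λ u → u , ≈ᴹ-refl) (λ v∈W → v∈W)
    (Counting.dimension K-finite (restrictScalars ι (asModule U₁)) (t ℕ.* n)
      (≡.subst (Enumeration U₁.≈ᴹ-setoid) (^-*-assoc q t n) (enumerate U₁-dim)))

  -- This is why `W ρ` is scattered. The `U₁` components give `u′ = a u`; inserting this into the
  -- `U₂` components gives `ρ σ(a) f u = ρ a f u`. Hence `σ` fixes `a`, and `a` comes from `K`.
  graph-scalar : ∀ {a u u′} → ¬ proj₁ u ≈ᴹ 0ᴹ → graph u′ ≈ᴹ a *ₗ graph u → ∃ λ k → ι.⟦ k ⟧ ≈ a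
  graph-scalar {a} {u} {u′} u≉0 eq = Equivalence.to (fixed a) (*-injective ρ≉0
    (scalar-unique (f≉0 u u≉0) (begin
      (ρ * σ a) *ₗ proj₁ (f u)       ≈⟨ ρf-* a u ⟨
      ρ *ₗ proj₁ (f (a U₁.*ₗ u))     ≈⟨ *ₗ-congˡ (f.cong (proj₁ components)) ⟨
      ρ *ₗ proj₁ (f u′)              ≈⟨ proj₂ components ⟩
      (ρ * a) *ₗ proj₁ (f u)         ∎)))
    where
    components : proj₁ u′ ≈ᴹ a *ₗ proj₁ u × ρ *ₗ proj₁ (f u′) ≈ᴹ (ρ * a) *ₗ proj₁ (f u)
    components = components-unique (proj₂ u′) (*-closed U₁ a (proj₂ u)) (ρf∈ u′)
      (*-closed U₂ (ρ * a) (proj₂ (f u))) (≈ᴹ-trans eq (*-graph a u))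

  W-scattered : Scattered (W ρ)
  W-scattered P P∈L with u , u≉0 , P≐ ← proj₂ ℒ≐L[W] {P} P∈L = record
    { basis       = λ _ → graph u
    ; basis∈      = λ _ → proj₂ P≐ (generator∈ (graph u)) , u , ≈ᴹ-refl
    ; independent = λ { c eq zero → ι-injective (scale≈0 (graph≉0 u u≉0)
        (≈ᴹ-trans (≈ᴹ-sym (+ᴹ-identityʳ _)) eq)) }
    ; spanning    = λ { (v∈P , u′ , v≈) →
        let a , v≈a = proj₁ P≐ v∈P
            k , ιk≈a = graph-scalar {a} {u} {u′} u≉0 (≈ᴹ-trans (≈ᴹ-sym v≈) v≈a)
        in (λ _ → k) , ≈ᴹ-trans v≈a (≈ᴹ-trans (*ₗ-congʳ (≈-sym ιk≈a)) (≈ᴹ-sym (+ᴹ-identityʳ _))) }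
    }

  -- The lines joining corresponding points

  -- Defined on vectors so that `f` applies directly; at `r i` it unfolds to the join of `point i`
  -- and its image under `Φ`.
  line : U₁.Carrierᴹ → Subspace
  line u = span (proj₁ u) ∨ span (proj₁ (f u))

  line⁺ : ∀ {x y} u → x ∈ₛ span (proj₁ u) → y ∈ₛ span (proj₁ (f u)) → (x +ᴹ y) ∈ₛ line u
  line⁺ u x∈ y∈ = _ , _ , x∈ , y∈ , ≈ᴹ-refl

  -- The two spans generating the line lie in `U₁` and `U₂`, so the decomposition given by
  -- membership is the one along the direct sum.
  line⁻ : ∀ {x y} u → x ∈ₛ U₁ → y ∈ₛ U₂ → (x +ᴹ y) ∈ₛ line u →
          x ∈ₛ span (proj₁ u) × y ∈ₛ span (proj₁ (f u))
  line⁻ u x∈ y∈ (x′ , y′ , x′∈ , y′∈ , eq) =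
    let x≈ , y≈ = components-unique x∈ (span-least U₁ (proj₂ u) x′∈)
                                    y∈ (span-least U₂ (proj₂ (f u)) y′∈) eq
    in resp (span _) (≈ᴹ-sym x≈) x′∈ , resp (span _) (≈ᴹ-sym y≈) y′∈

  line-dimension : ∀ u → ¬ proj₁ u ≈ᴹ 0ᴹ → HasDim (line u) 2
  line-dimension u u≉0 = record
    { basis       = b
    ; basis∈      = λ { zero → resp (line u) (+ᴹ-identityʳ _) (line⁺ u (generator∈ _) (0∈ (span _)))
                      ; (suc zero) → resp (line u) (+ᴹ-identityˡ _)
                          (line⁺ u (0∈ (span _)) (generator∈ _)) }
    ; independent = λ c eq →
        let au≈0 , bfu≈0 = components≈0 (*-closed U₁ (c zero) (proj₂ u))
                             (*-closed U₂ (c (suc zero)) (proj₂ (f u)))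
                             (≈ᴹ-trans (+ᴹ-congˡ (≈ᴹ-sym (+ᴹ-identityʳ _))) eq)
        in λ { zero → scale≈0 u≉0 au≈0 ; (suc zero) → scale≈0 (f≉0 u u≉0) bfu≈0 }
    ; spanning    = λ { (x , y , (a , x≈) , (b , y≈) , v≈) → (a ∷ λ _ → b) ,
        ≈ᴹ-trans v≈ (+ᴹ-cong x≈ (≈ᴹ-trans y≈ (≈ᴹ-sym (+ᴹ-identityʳ _)))) }
    }
    where
    b : Vector Carrierᴹ 2
    b zero    = proj₁ u
    b (suc _) = proj₁ (f u)

  -- A vector of `W ρ` on the line has a multiple of `u` as its `U₁` component, so the intersection
  -- is parametrised by `a ↦ graph (a u)` with `a` in `F`. Regarded as a `K`-space, `F` has `q ^ t`
  -- elements and hence dimension `t`.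
  line-weight : ∀ u → ¬ proj₁ u ≈ᴹ 0ᴹ → HasWeight (W ρ) (line u) t
  line-weight u u≉0 = image-dimension K {M = Fᴷ} {N = restrictScalars ι V}
    {φ = λ a → graph (a U₁.*ₗ u)}
    (λ a b → ≈ᴹ-trans (graph-cong {(a + b) U₁.*ₗ u} {a U₁.*ₗ u U₁.+ᴹ b U₁.*ₗ u} (*ₗ-distribʳ _ a b))
                      (graph-+ (a U₁.*ₗ u) (b U₁.*ₗ u)))
    (λ k a → ≈ᴹ-trans (graph-cong {(ι.⟦ k ⟧ * a) U₁.*ₗ u} {ι.⟦ k ⟧ U₁.*ₗ (a U₁.*ₗ u)} (*ₗ-assoc _ a _))
                      (graph-* k (a U₁.*ₗ u)))
    (λ a eq → scale≈0 u≉0 (graph≈0 (a U₁.*ₗ u) eq))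
    (λ {a} {b} a≈b → graph-cong {a U₁.*ₗ u} {b U₁.*ₗ u} (*ₗ-congʳ a≈b))
    (restrictSubmodule ι (line u) ∩ₛ W ρ)
    (λ a → line⁺ u (a , ≈ᴹ-refl) (_ , ρf-* a u) , a U₁.*ₗ u , ≈ᴹ-refl)
    (λ { (v∈line , u′ , v≈) →
      let a , u′≈ = proj₁ (line⁻ u (proj₂ u′) (ρf∈ u′) (resp (line u) v≈ v∈line))
      in a , ≈ᴹ-trans v≈ (graph-cong {u′} {a U₁.*ₗ u} u′≈) })
    (Counting.dimension K-finite Fᴷ t enumeration)
    where
    Fᴷ : LeftModule K.ring ℓ ℓ
    Fᴷ = restrictScalars ι (TensorUnit.leftModule {R = F.ring})

  -- A common nonzero vector has a nonzero component. If it is the one in `U₁`, it spans both `u`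
  -- and a part of the span of `u′`; otherwise the same comparison is made in `U₂` and pulled back
  -- through `f`.
  lines-meet⇒∈span : ∀ {v} u u′ → ¬ v ≈ᴹ 0ᴹ → v ∈ₛ line u → v ∈ₛ line u′ → proj₁ u ∈ₛ span (proj₁ u′)
  lines-meet⇒∈span u u′ v≉0 (x , y , x∈ , y∈ , v≈) v∈line′
    with x∈′ , y∈′ ← line⁻ u′ (span-least U₁ (proj₂ u) x∈) (span-least U₂ (proj₂ (f u)) y∈)
                       (resp (line u′) v≈ v∈line′)
    with x ≟ᴹ 0ᴹ
  ... | no x≉0 = span-least (span _) x∈′ (span-swap x≉0 x∈)
  ... | yes x≈0 = f-span⁻ u u′ (span-least (span _) y∈′ (span-swap y≉0 y∈))
    where
    y≉0 : ¬ y ≈ᴹ 0ᴹ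
    y≉0 y≈0 = v≉0 (≈ᴹ-trans v≈ (≈ᴹ-trans (+ᴹ-cong x≈0 y≈0) (+ᴹ-identityˡ 0ᴹ)))

  -- The pseudoregulus and its two transversals

  open Points U₁-dim

  m : ℕ
  m = pointCount (q ^ t) n

  m-* : m ℕ.* (q ^ t ∸ 1) ≡ q ^ (n ℕ.* t) ∸ 1
  m-* = ≡.trans (pointCount-* (q ^ t) {{order≢0}} n)
    (cong (_∸ 1) (≡.trans (^-*-assoc q t n) (cong (q ^_) (ℕₚ.*-comm t n))))
    where
    order≢0 : ℕ.NonZero (q ^ t)
    order≢0 = ℕ.>-nonZero (<⇒≤ 1<order)

  r : Fin m → U₁.Carrierᴹ
  r i = vec (point i) , vec∈ (point i)

  r≉0 : ∀ i → ¬ proj₁ (r i) ≈ᴹ 0ᴹ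
  r≉0 i = vec≉0 (point i)

  lines-disjoint : ∀ i j → i ≢ j → Disjoint (line (r i)) (line (r j))
  lines-disjoint i j i≢j (P , P∈i , P∈j) =
    i≢j (point-unique i j (lines-meet⇒∈span (r i) (r j) (vec≉0 P) P∈i P∈j))

  -- A point of `U₁` in the linear set would put `graph u`, and so the nonzero vector `ρ f u` of
  -- `U₂`, into `U₁`. For `U₂` the roles of the two summands are exchanged.
  U₁-disjoint : DisjointFrom U₁ (ℒ ρ)
  U₁-disjoint (P , P∈U₁ , u , u≉0 , P≐) = scale≉0 ρ≉0 (f≉0 u u≉0)
    (direct.independent
      (+-cancelˡ-∈ U₁ (proj₂ u) (span-least U₁ P∈U₁ (proj₂ P≐ (generator∈ _))))
      (ρf∈ u))

  U₂-disjoint : DisjointFrom U₂ (ℒ ρ)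
  U₂-disjoint (P , P∈U₂ , u , u≉0 , P≐) = u≉0
    (direct.independent (proj₂ u)
      (+-cancelˡ-∈ U₂ (ρf∈ u) (resp U₂ (+ᴹ-comm _ _)
        (span-least U₂ P∈U₂ (proj₂ P≐ (generator∈ _))))))

  U₁-meets : ∀ i → Meets U₁ (line (r i))
  U₁-meets i = record { vec = proj₁ (r i) ; vec∈ = _ ; vec≉0 = r≉0 i } , proj₂ (r i) ,
    resp (line (r i)) (+ᴹ-identityʳ _) (line⁺ (r i) (generator∈ _) (0∈ (span _)))

  U₂-meets : ∀ i → Meets U₂ (line (r i))
  U₂-meets i = record { vec = proj₁ (f (r i)) ; vec∈ = _ ; vec≉0 = f≉0 (r i) (r≉0 i) } ,
    proj₂ (f (r i)) ,
    resp (line (r i)) (+ᴹ-identityˡ _) (line⁺ (r i) (0∈ (span _)) (generator∈ _))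

  U₁≢U₂ : ¬ U₁ ≐ₛ U₂
  -- If the two were equal, `U₁` would be zero, that is, contained in the span of `0ᴹ`.
  U₁≢U₂ (U₁⊆U₂ , _) = dimension≥2⇒⊈span 2≤n U₁-dim 0ᴹ λ w∈U₁ →
    resp (span 0ᴹ) (≈ᴹ-sym (direct.independent w∈U₁ (U₁⊆U₂ w∈U₁))) (0∈ (span 0ᴹ))

  -- Uniqueness of the transversals

  span? : ∀ v → Unary.Decidable (Mem (span v))
  span? v w = search (λ a≈b eq → ≈ᴹ-trans eq (*ₗ-congʳ a≈b)) (λ a → w ≟ᴹ a *ₗ v)

  module Transversals (T : Subspace) (T-dim : HasDim T n) (T-meets : ∀ i → Meets T (line (r i)))
    where
    private
      module Tᵖ = Points T-dim

    P : Fin m → Λ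
    P i = proj₁ (T-meets i)

    P∈T : ∀ i → vec (P i) ∈ₛ T
    P∈T i = proj₁ (proj₂ (T-meets i))

    P∈line : ∀ i → vec (P i) ∈ₛ line (r i)
    P∈line i = proj₂ (proj₂ (T-meets i))

    index : Fin m → Fin m
    index i = proj₁ (Tᵖ.point-cover (P∈T i) (vec≉0 (P i)))

    P∈index : ∀ i → vec (P i) ∈ₛ ⟪ Tᵖ.point (index i) ⟫
    P∈index i = proj₂ (Tᵖ.point-cover (P∈T i) (vec≉0 (P i)))

    -- If `P i` and `P j` are the same point of `T`, that point lies on the lines of both `r i` and
    -- `r j`, which are disjoint for distinct indices.
    index-injective : Injective _≡_ _≡_ index
    index-injective {i} {j} eq = point-unique i j
      (lines-meet⇒∈span (r i) (r j) (vec≉0 (P i)) (P∈line i) (span-least (line (r j)) (P∈line j)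
        (span-common (vec≉0 (P j))
          (≡.subst (λ k → vec (P i) ∈ₛ ⟪ Tᵖ.point k ⟫) eq (P∈index i)) (P∈index j))))

    -- T has as many points as there are lines, so the points P i exhaust T.
    T-cover : ∀ {v} → v ∈ₛ T → ¬ v ≈ᴹ 0ᴹ → ∃ λ i → v ∈ₛ span (vec (P i))
    T-cover {v} v∈T v≉0 =
      let k , v∈k = Tᵖ.point-cover v∈T v≉0
          i , i↦k = injective⇒surjective index index-injective k
      in i , span-common (vec≉0 (P i)) v∈k
               (≡.subst (λ k → vec (P i) ∈ₛ ⟪ Tᵖ.point k ⟫) i↦k (P∈index i))

    -- By `T-cover` the vectors are multiples of some `P i` and `P j`. Both of these lines meet the
    -- line of `u`, which forces `i` and `j` to coincide; so both vectors lie on the single point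
    -- `P i`.
    T∩line : ∀ {v v′} u → v ∈ₛ T → v′ ∈ₛ T → v ∈ₛ line u → v′ ∈ₛ line u → ¬ v ≈ᴹ 0ᴹ → v′ ∈ₛ span v
    T∩line {v} {v′} u v∈T v′∈T v∈line v′∈line v≉0 with v′ ≟ᴹ 0ᴹ
    ... | yes v′≈0 = resp (span v) (≈ᴹ-sym v′≈0) (0∈ (span v))
    ... | no v′≉0 =
      let i , v∈i = T-cover v∈T v≉0
          j , v′∈j = T-cover v′∈T v′≉0
          i≡j = point-unique i j (span-least (span _)
            (lines-meet⇒∈span u (r j) v′≉0 v′∈line (span-least (line (r j)) (P∈line j) v′∈j))
            (lines-meet⇒∈span (r i) u v≉0 (span-least (line (r i)) (P∈line i) v∈i) v∈line))
      in span-common v≉0 v′∈j (≡.subst (λ k → v ∈ₛ span (vec (P k))) i≡j v∈i)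

    -- `T-cover` places `x + y` on the line of some `r i`. As `x` is nonzero it spans the same point
    -- as `r i`, so `f (r i)`, and with it `y`, is a multiple of `f x`.
    aligned : ∀ (x : U₁.Carrierᴹ) {y} → y ∈ₛ U₂ → (proj₁ x +ᴹ y) ∈ₛ T → ¬ proj₁ x ≈ᴹ 0ᴹ →
              y ∈ₛ span (proj₁ (f x))
    aligned x y∈U₂ v∈T x≉0 =
      let i , v∈i = T-cover v∈T λ v≈0 → x≉0 (proj₁ (components≈0 (proj₂ x) y∈U₂ v≈0))
          x∈ , y∈ = line⁻ (r i) (proj₂ x) y∈U₂ (span-least (line (r i)) (P∈line i) v∈i)
      in span-least (span _) (f-span (r i) x (span-swap x≉0 x∈)) y∈

    module Mixed (x : U₁.Carrierᴹ) {y : Carrierᴹ} (y∈U₂ : y ∈ₛ U₂) (v∈T : (proj₁ x +ᴹ y) ∈ₛ T)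
                 (x≉0 : ¬ proj₁ x ≈ᴹ 0ᴹ) (y≉0 : ¬ y ≈ᴹ 0ᴹ) where

      y∈fx : y ∈ₛ span (proj₁ (f x))
      y∈fx = aligned x y∈U₂ v∈T x≉0

      μ : Carrier
      μ = proj₁ y∈fx

      μ≉0 : ¬ μ ≈ 0#
      μ≉0 μ≈0 = y≉0 (≈ᴹ-trans (proj₂ y∈fx) (≈ᴹ-trans (*ₗ-congʳ μ≈0) (*ₗ-zeroˡ _)))

      module _ (x′ : U₁.Carrierᴹ) {y′ : Carrierᴹ} (y′∈U₂ : y′ ∈ₛ U₂) (v′∈T : (proj₁ x′ +ᴹ y′) ∈ₛ T)
        where

        -- Taking a = 1 in twisted gives μ = μ′, so that σ a = a for every a.
        x′∈span : proj₁ x′ ∈ₛ span (proj₁ x)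
        x′∈span = decidable-stable (span? (proj₁ x) (proj₁ x′)) λ x′∉ →
          let y′∈fx′ = aligned x′ y′∈U₂ v′∈T λ x′≈0 →
                x′∉ (resp (span (proj₁ x)) (≈ᴹ-sym x′≈0) (0∈ (span (proj₁ x))))
              μ′ = proj₁ y′∈fx′

              twisted : ∀ a → a * μ ≈ μ′ * σ a
              twisted a =
                let ax+x′ = a U₁.*ₗ x U₁.+ᴹ x′
                    b , ay+y′≈ = aligned ax+x′ (+-closed U₂ (*-closed U₂ a y∈U₂) y′∈U₂)
                      (resp T (≈ᴹ-trans (+ᴹ-congʳ (*ₗ-distribˡ a _ _)) (+ᴹ-interchange _ _ _ _))
                        (+-closed T (*-closed T a v∈T) v′∈T))
                      λ ax+x′≈0 → x′∉ (+-cancelˡ-∈ (span (proj₁ x)) (a , ≈ᴹ-refl)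
                        (resp (span (proj₁ x)) (≈ᴹ-sym ax+x′≈0) (0∈ (span (proj₁ x)))))
                    -- `f x` and `f x′` are independent because `x` and `x′` are, so
                    -- `a y + y′ = b f(a x + x′)` may be compared coefficientwise: `a μ = b σ(a)`
                    -- and `μ′ = b`.
                    aμ≈ , μ′≈b = coefficients-unique (f≉0 x x≉0) (x′∉ ∘ f-span⁻ x′ x) (begin
                      (a * μ) *ₗ proj₁ (f x) +ᴹ μ′ *ₗ proj₁ (f x′)
                        ≈⟨ +ᴹ-congʳ (*ₗ-assoc a μ _) ⟩
                      a *ₗ (μ *ₗ proj₁ (f x)) +ᴹ μ′ *ₗ proj₁ (f x′)
                        ≈⟨ +ᴹ-cong (*ₗ-congˡ (proj₂ y∈fx)) (proj₂ y′∈fx′) ⟨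
                      a *ₗ y +ᴹ y′
                        ≈⟨ ay+y′≈ ⟩
                      b *ₗ proj₁ (f ax+x′)
                        ≈⟨ *ₗ-congˡ (≈ᴹ-trans (f.additive (a U₁.*ₗ x) x′)
                             (+ᴹ-congʳ (f.σ-homogeneous a x))) ⟩
                      b *ₗ (σ a *ₗ proj₁ (f x) +ᴹ proj₁ (f x′))
                        ≈⟨ *ₗ-distribˡ b _ _ ⟩
                      b *ₗ (σ a *ₗ proj₁ (f x)) +ᴹ b *ₗ proj₁ (f x′)
                        ≈⟨ +ᴹ-congʳ (*ₗ-assoc b (σ a) _) ⟨
                      (b * σ a) *ₗ proj₁ (f x) +ᴹ b *ₗ proj₁ (f x′) ∎)
                in ≈-trans aμ≈ (*-congʳ (≈-sym μ′≈b))

              μ≈μ′ : μ ≈ μ′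
              μ≈μ′ = ≈-trans (≈-sym (F.*-identityˡ μ)) (≈-trans (twisted 1#)
                (≈-trans (*-congˡ σ.1#-homo) (F.*-identityʳ μ′)))

              a , σa≉a = moved
          in σa≉a (≈-sym (*-injective μ≉0
               (≈-trans (*-comm μ a) (≈-trans (twisted a) (*-congʳ (≈-sym μ≈μ′))))))

        y′∈span : y′ ∈ₛ span (proj₁ (f x))
        y′∈span with proj₁ x′ ≟ᴹ 0ᴹ
        ... | no x′≉0 = span-least (span _) (f-span x′ x x′∈span) (aligned x′ y′∈U₂ v′∈T x′≉0)
        -- `aligned` requires a nonzero `U₁` component, so it is applied to the sum of the two
        -- vectors of `T`, and `y` is cancelled afterwards.
        ... | yes x′≈0 = +-cancelˡ-∈ (span _) y∈fx (span-least (span _)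
          (f-span (x U₁.+ᴹ x′) x (+-closed (span _) (generator∈ _) x′∈span))
          (aligned (x U₁.+ᴹ x′) (+-closed U₂ y∈U₂ y′∈U₂)
            (resp T (+ᴹ-interchange _ _ _ _) (+-closed T v∈T v′∈T))
            λ x+x′≈0 → x≉0 (begin
              proj₁ x                ≈⟨ +ᴹ-identityʳ _ ⟨
              proj₁ x +ᴹ 0ᴹ          ≈⟨ +ᴹ-congˡ x′≈0 ⟨
              proj₁ x +ᴹ proj₁ x′    ≈⟨ x+x′≈0 ⟩
              0ᴹ                     ∎)))

        -- Both vectors lie on the line of `x`, which meets `T` in one point only.
        v′∈span : (proj₁ x′ +ᴹ y′) ∈ₛ span (proj₁ x +ᴹ y)
        v′∈span = T∩line x v∈T v′∈T (line⁺ x (generator∈ _) y∈fx) (line⁺ x x′∈span y′∈span)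
          (x≉0 ∘ proj₁ ∘ components≈0 (proj₂ x) y∈U₂)

      impossible : ⊥
      impossible = dimension≥2⇒⊈span 2≤n T-dim (proj₁ x +ᴹ y) λ {w} w∈T →
        let x′ , y′ , x′∈ , y′∈ , w≈ = direct.spanning w
        in resp (span _) (≈ᴹ-sym w≈) (v′∈span (x′ , x′∈) y′∈ (resp T w≈ w∈T))

    not-mixed : ∀ {x y} → x ∈ₛ U₁ → y ∈ₛ U₂ → (x +ᴹ y) ∈ₛ T → x ≈ᴹ 0ᴹ ⊎ y ≈ᴹ 0ᴹ
    not-mixed {x} {y} x∈ y∈ v∈T with x ≟ᴹ 0ᴹ | y ≟ᴹ 0ᴹ
    ... | yes x≈0 | _       = inj₁ x≈0
    ... | no _    | yes y≈0 = inj₂ y≈0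
    ... | no x≉0  | no y≉0  = ⊥-elim (Mixed.impossible (x , x∈) y∈ v∈T x≉0 y≉0)

    T⊆U₁⊎U₂ : ∀ {v} → v ∈ₛ T → v ∈ₛ U₁ ⊎ v ∈ₛ U₂
    T⊆U₁⊎U₂ {v} v∈T with x , y , x∈ , y∈ , v≈ ← direct.spanning v
      with not-mixed x∈ y∈ (resp T v≈ v∈T)
    ... | inj₁ x≈0 = inj₂ (resp U₂ (≈ᴹ-sym (≈ᴹ-trans v≈ (≈ᴹ-trans (+ᴹ-congʳ x≈0) (+ᴹ-identityˡ y)))) y∈)
    ... | inj₂ y≈0 = inj₁ (resp U₁ (≈ᴹ-sym (≈ᴹ-trans v≈ (≈ᴹ-trans (+ᴹ-congˡ y≈0) (+ᴹ-identityʳ x)))) x∈)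

    -- The line of `r i` meets `U₁` only in the point of `r i`, so `P i` must be that point. Hence
    -- `T` contains every `r i`, and these represent all points of `U₁`.
    ⊆U₁⇒≐ : (∀ {v} → v ∈ₛ T → v ∈ₛ U₁) → T ≐ₛ U₁
    ⊆U₁⇒≐ T⊆U₁ = T⊆U₁ , U₁⊆T
      where
      r∈T : ∀ i → proj₁ (r i) ∈ₛ T
      r∈T i = span-least T (P∈T i) (span-swap (vec≉0 (P i))
        (proj₁ (line⁻ (r i) (T⊆U₁ (P∈T i)) (0∈ U₂)
          (resp (line (r i)) (≈ᴹ-sym (+ᴹ-identityʳ _)) (P∈line i)))))

      U₁⊆T : ∀ {x} → x ∈ₛ U₁ → x ∈ₛ T
      U₁⊆T {x} x∈U₁ with x ≟ᴹ 0ᴹ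
      ... | yes x≈0 = resp T (≈ᴹ-sym x≈0) (0∈ T)
      ... | no x≉0  = let i , x∈i = point-cover x∈U₁ x≉0 in span-least T (r∈T i) x∈i

    -- Here `P i` is the point of `f (r i)`; surjectivity of `f` ensures that these points exhaust
    -- `U₂`.
    ⊆U₂⇒≐ : (∀ {v} → v ∈ₛ T → v ∈ₛ U₂) → T ≐ₛ U₂
    ⊆U₂⇒≐ T⊆U₂ = T⊆U₂ , U₂⊆T
      where
      fr∈T : ∀ i → proj₁ (f (r i)) ∈ₛ T
      fr∈T i = span-least T (P∈T i) (span-swap (vec≉0 (P i))
        (proj₂ (line⁻ (r i) (0∈ U₁) (T⊆U₂ (P∈T i))
          (resp (line (r i)) (≈ᴹ-sym (+ᴹ-identityˡ _)) (P∈line i)))))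

      U₂⊆T : ∀ {y} → y ∈ₛ U₂ → y ∈ₛ T
      U₂⊆T {y} y∈U₂ with y ≟ᴹ 0ᴹ
      ... | yes y≈0 = resp T (≈ᴹ-sym y≈0) (0∈ T)
      ... | no y≉0 with x , fx≈ ← proj₂ bijective (y , y∈U₂) =
        let fx≈y = fx≈ {x} ≈ᴹ-refl
            i , x∈i = point-cover (proj₂ x) λ x≈0 → y≉0 (≈ᴹ-trans (≈ᴹ-sym fx≈y) (f≈0 x x≈0))
        in span-least T (fr∈T i) (resp (span _) fx≈y (f-span x (r i) x∈i))

    -- One nonzero vector `b` of `T` chooses the side for all of `T`: a vector `v` of `T` on the
    -- other side would make `b + v` mixed unless it is zero.
    T≐U₁⊎T≐U₂ : T ≐ₛ U₁ ⊎ T ≐ₛ U₂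
    T≐U₁⊎T≐U₂ with b , b∈T , b≉0 ← nonzero (<⇒≤ 2≤n) T-dim
      with T⊆U₁⊎U₂ b∈T
    ... | inj₁ b∈U₁ = inj₁ (⊆U₁⇒≐ λ {v} v∈T → [ (λ v∈U₁ → v∈U₁) , (λ v∈U₂ →
            [ ⊥-elim ∘ b≉0 , (λ v≈0 → resp U₁ (≈ᴹ-sym v≈0) (0∈ U₁)) ]′
            (not-mixed b∈U₁ v∈U₂ (+-closed T b∈T v∈T))) ]′ (T⊆U₁⊎U₂ v∈T))
    ... | inj₂ b∈U₂ = inj₂ (⊆U₂⇒≐ λ {v} v∈T → [ (λ v∈U₁ →
            [ (λ v≈0 → resp U₂ (≈ᴹ-sym v≈0) (0∈ U₂)) , ⊥-elim ∘ b≉0 ]′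
            (not-mixed v∈U₁ b∈U₂ (+-closed T v∈T b∈T))) , (λ v∈U₂ → v∈U₂) ]′ (T⊆U₁⊎U₂ v∈T))

  -- Assembly of the pseudoregulus and the theorem

  pseudoregulusType : PseudoregulusType q t n (ℒ ρ) (W ρ)
  pseudoregulusType = record
    { definedBy      = ℒ≐L[W]
    ; rank           = W-rank
    ; scattered      = W-scattered
    ; m              = m
    ; m≡             = m-*
    ; s              = λ i → line (r i)
    ; s-line         = λ i → line-dimension (r i) (r≉0 i)
    ; s-weight       = λ i → line-weight (r i) (r≉0 i)
    ; s-disjoint     = lines-disjoint
    ; T₁             = U₁
    ; T₂             = U₂
    ; T₁-transversal = U₁-dim , U₁-disjoint , U₁-meets
    ; T₂-transversal = U₂-dim , U₂-disjoint , U₂-meets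
    ; T₁≢T₂          = U₁≢U₂
    ; only-T₁-T₂     = λ { T (T-dim , _ , T-meets) → Transversals.T≐U₁⊎T≐U₂ T T-dim T-meets }
    }

  ∨-mono : ∀ {A A′ B B′ : Subspace} → (∀ {v} → v ∈ₛ A → v ∈ₛ A′) → (∀ {v} → v ∈ₛ B → v ∈ₛ B′) →
           ∀ {v} → v ∈ₛ A ∨ B → v ∈ₛ A′ ∨ B′
  ∨-mono A⊆A′ B⊆B′ (x , y , x∈A , y∈B , v≈) = x , y , A⊆A′ x∈A , B⊆B′ y∈B , v≈

  -- Any point of `U₁` coincides with some `point i`, and `Φ` respects coincidence of points, so the
  -- lines indexed by `Fin m` already include every join of corresponding points.
  pseudoregulus≐ : PseudoregulusType.pseudoregulus pseudoregulusType ≐ linesJoiningCorrespondingPoints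
  pseudoregulus≐ =
    (λ { (i , X≐) → point i , X≐ }) ,
    (λ { (P , X⊆ , ⊆X) →
      let i , P∈i = point-cover (vec∈ P) (vec≉0 P)
          P≐i = span≐ (vec≉0 P) P∈i
          ΦP≐Φi = Φ-cong P (point i) P≐i
      in i , (λ v∈X → ∨-mono {⟪ P ⟫} {⟪ point i ⟫} {⟪ Φ P ⟫} {⟪ Φ (point i) ⟫}
                        (proj₁ P≐i) (proj₁ ΦP≐Φi) (X⊆ v∈X))
           , (λ v∈s → ⊆X (∨-mono {⟪ point i ⟫} {⟪ P ⟫} {⟪ Φ (point i) ⟫} {⟪ Φ P ⟫}
                        (proj₂ P≐i) (proj₂ ΦP≐Φi) v∈s)) })

open import Data.Nat using (_*_)

theorem3p5 :
    ∀ {ℓ : Level} (q t n : ℕ) → 2 ≤ t → 2 ≤ n →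
    -- K = 𝔽_q, embedded by ι in F = 𝔽_{q^t}
    (K F : CommutativeRing ℓ ℓ) → IsFiniteField K q → IsFiniteField F (q ^ t) →
    (ι : RingHomomorphism (CommutativeRing.rawRing K) (CommutativeRing.rawRing F)) →
    (V : LeftModule (CommutativeRing.ring F) ℓ ℓ) → HasDim (full {M = V}) (2 * n) →
    (U₁ U₂ : Submodule V) → IsDirectSum U₁ U₂ → HasDim U₁ n → HasDim U₂ n →
    (σ : CommutativeRing.Carrier F → CommutativeRing.Carrier F) →
    RingMorphisms.IsRingIsomorphism (CommutativeRing.rawRing F) (CommutativeRing.rawRing F) σ →
    (fixed : HasFixedField {K = K} {F = F} ι σ) →
    (f : LeftModule.Carrierᴹ (asModule U₁) → LeftModule.Carrierᴹ (asModule U₂)) →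
    (semilinear : IsSemilinear σ (asModule U₁) (asModule U₂) f) →
    (bijective : Bijective (LeftModule._≈ᴹ_ (asModule U₁)) (LeftModule._≈ᴹ_ (asModule U₂)) f) →
    (ρ : CommutativeRing.Carrier F) → ¬ CommutativeRing._≈_ F ρ (CommutativeRing.0# F) →
    let open LinearSets {K = K} {F = F} ι V
        open SemilinearMap U₁ U₂ σ f semilinear bijective fixed
        open PseudoregulusType
    in
    Σ (PseudoregulusType q t n (ℒ ρ) (W ρ)) λ L →
      pseudoregulus L ≐ linesJoiningCorrespondingPoints ×
      T₁ L ≐ₛ U₁ ×
      T₂ L ≐ₛ U₂
theorem3p5 q t n 2≤t 2≤n K F K-finite F-finite ι V V-dim U₁ U₂ direct U₁-dim U₂-dim σ σ-iso
           fixed f semilinear bijective ρ ρ≉0 =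
  pseudoregulusType , pseudoregulus≐ , ((λ v∈ → v∈) , (λ v∈ → v∈)) , ((λ v∈ → v∈) , (λ v∈ → v∈))
  where
  open Pseudoregulus q t n 2≤t 2≤n K F K-finite F-finite ι V V-dim U₁ U₂ direct U₁-dim U₂-dim
    σ σ-iso fixed f semilinear bijective ρ ρ≉0
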